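{- Let $3<q<r$ be odd primes and write $\Psi_{3qr}(x)=\sum_k c_{3qr}(k)x^k$. (1) If $q\equiv 1\pmod 3$, $r\equiv 1\pmod 3$ and $r\le 2q-7$, then $V_{3qr}=\{ -2,-1,0,1,2\}$; in particular $c_{3qr}(r+1)=2$ and $c_{3qr}(r+1+qr)=-2$. (2) If $q\equiv 2\pmod 3$, $r\equiv 2\pmod 3$ and $r\le 2q-3$, then $V_{3qr}=\{ -2,-1,0,1,2\}$; in particular $c_{3qr}(r)=-2$ and $c_{3qr}(r+qr)=2$. (3) In all remaining cases $V_{3qr}=\{ -1,0,1\}$, so that $\Psi_{3qr}(x)$ is flat.
   Context: $\Phi_n(x)$ is the $n$-th cyclotomic polynomial, $\varphi$ is Euler's totient function, and $\Psi_n(x)=(x^n-1)/\Phi_n(x)=\sum_{k=0}^{n-\varphi(n)}c_n(k)x^k\in\mathbb Z[x]$. $V_n=\{c_n(k):0\le k\le n-\varphi(n)\}$. A polynomial in $\mathbb Z[x]$ is flat if the maximum absolute value of its coefficients equals $1$. -}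

module Defs where

open import Data.Nat as ℕ using (ℕ; zero; suc; _∸_; _<ᵇ_; _≤_)
open import Data.Nat.GCD using (gcd)
open import Data.Nat.Divisibility using (_∣?_)
open import Data.Integer as ℤ using (ℤ; +_; -[1+_]; ∣_∣)
open import Data.List using (List; []; _∷_; [_]; map; foldr; filter; length; reverse; replicate; drop; upTo; _++_)
open import Data.Bool using (if_then_else_)
open import Data.Product using (Σ; ∃; _×_)
open import Relation.Binary.PropositionalEquality using (_≡_)

-- Integer polynomials as coefficient lists, lowest degree first:
-- the list a₀ ∷ a₁ ∷ … represents a₀ + a₁x + a₂x² + …
Poly : Set
Poly = List ℤ

coeff : Poly → ℕ → ℤ
coeff []      k       = + 0
coeff (a ∷ p) zero    = a
coeff (a ∷ p) (suc k) = coeff p k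

infixl 6 _⊕_
infixl 7 _⊗_

_⊕_ : Poly → Poly → Poly
[]      ⊕ q       = q
(a ∷ p) ⊕ []      = a ∷ p
(a ∷ p) ⊕ (b ∷ q) = (a ℤ.+ b) ∷ (p ⊕ q)

scale : ℤ → Poly → Poly
scale c p = map (c ℤ.*_) p

_⊗_ : Poly → Poly → Poly
[]      ⊗ q = []
(a ∷ p) ⊗ q = scale a q ⊕ (+ 0 ∷ (p ⊗ q))

prodP : List Poly → Poly
prodP = foldr _⊗_ [ + 1 ]

xPowMinusOne : ℕ → Poly
xPowMinusOne zero    = []
xPowMinusOne (suc m) = -[1+ 0 ] ∷ (replicate m (+ 0) ++ [ + 1 ])

-- Long division by a monic divisor, on coefficient lists written
-- highest degree first.  divH fuel a b = quotient of a by b (b monic,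
-- i.e. its first entry is 1).
private
  subPrefix : List ℤ → List ℤ → List ℤ
  subPrefix as       []       = as
  subPrefix []       (c ∷ cs) = map ℤ.-_ (c ∷ cs)
  subPrefix (a ∷ as) (c ∷ cs) = (a ℤ.- c) ∷ subPrefix as cs

  divH : ℕ → List ℤ → List ℤ → List ℤ
  divH zero    a        b = []
  divH (suc f) []       b = []
  divH (suc f) (a ∷ as) b =
    if length (a ∷ as) <ᵇ length b
      then []
      else a ∷ divH f (subPrefix as (scale a (drop 1 b))) b

-- Quotient of polynomial long division of a by a monic polynomial b
-- (only ever applied to monic divisors without trailing zeros).
quotMonic : Poly → Poly → Poly
quotMonic a b = reverse (divH (length a) (reverse a) (reverse b))

properDivisors : ℕ → List ℕ
properDivisors n = filter (_∣? n) (map suc (upTo (n ∸ 1)))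

-- Cyclotomic polynomials via the standard recursion
--   Φ_n(x) = (x^n - 1) / ∏_{d ∣ n, d < n} Φ_d(x),
-- using a fuel argument (fuel n suffices for Φ_n).
cycFuel : ℕ → ℕ → Poly
cycFuel zero    n = [ + 1 ]
cycFuel (suc f) n = quotMonic (xPowMinusOne n) (prodP (map (cycFuel f) (properDivisors n)))

Φ : ℕ → Poly
Φ n = cycFuel n n

Ψ : ℕ → Poly
Ψ n = quotMonic (xPowMinusOne n) (Φ n)

c : ℕ → ℕ → ℤ
c n k = coeff (Ψ n) k

totient : ℕ → ℕ
totient n = length (filter (λ k → gcd k n ℕ.≟ 1) (map suc (upTo n)))

InV : ℕ → ℤ → Set
InV n v = ∃ λ k → (k ≤ n ∸ totient n) × (c n k ≡ v)

Flat : Poly → Set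
Flat p = (∀ k → ∣ coeff p k ∣ ≤ 1) × (∃ λ k → ∣ coeff p k ∣ ≡ 1)

-- Splitting x^n - 1 = ∏_{d ∣ n} Φ_d for n = 3qr gives Ψ_n = (x^qr - 1) F with
-- F = Φ₃ Φ₃q Φ₃r of degree below qr, so the coefficients of Ψ_n are those of -F
-- followed by those of F.  Moreover
--   Φ₃ F = (1 + x^q + x^2q) (1 + x^r + x^2r)
-- is a sum of nine monomials x^s.  Dividing by Φ₃ = 1 + x + x², the k-th coefficient
-- of F is the sum of u (k - s) over the exponents s ≤ k, where u = 1, -1, 0, 1, -1, 0, …
-- It depends only on k, q, r modulo 3 and on the number m of exponents that are
-- at most k, which leaves finitely many cases for each of the orders r ≤ 2q and
-- 2q ≤ r of the exponents.  Absolute value 2 occurs only for r ≤ 2q, q ≡ r (mod 3)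
-- and m = 3 or 6.

{-# OPTIONS --safe #-}
module Submission where

open import Defs
open import Algebra.Bundles using (CommutativeRing)
import Algebra.Solver.Ring as RingSolver
import Algebra.Solver.Ring.AlmostCommutativeRing as ACR
open import Data.Bool using (T; if_then_else_; true; false)
open import Data.Empty using (⊥; ⊥-elim)
open import Data.Integer using (ℤ; +_; -[1+_])
import Data.Integer as ℤ
import Data.Integer.Properties as ℤₚ
open import Algebra.Properties.AbelianGroup ℤₚ.+-0-abelianGroup using () renaming (∙-cancelʳ to +-cancelʳ)
open import Algebra.Properties.CommutativeSemigroup ℤₚ.+-commutativeSemigroup using () renaming (interchange to +-medial)
open import Data.List using (List; _∷_; []; [_]; _++_; _∷ʳ_; filter; length; map; replicate; reverse; take; upTo)
import Data.List.Properties as Listₚ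
open import Data.List.Membership.Propositional using (_∈_)
open import Data.List.Membership.Propositional.Properties
  using (∈-map⁺; ∈-map⁻; ∈-++⁺ˡ; ∈-++⁺ʳ; ∈-++⁻; ∈-upTo⁺; ∈-upTo⁻; ∈-filter⁺; ∈-filter⁻)
open import Data.List.Membership.Propositional.Properties.WithK using (unique∧set⇒bag)
open import Data.List.Relation.Binary.BagAndSetEquality using (∼bag⇒↭)
open import Data.List.Relation.Binary.Permutation.Propositional as Perm using (_↭_)
import Data.List.Relation.Binary.Permutation.Propositional.Properties as Permₚ
import Data.List.Relation.Unary.All as All
open import Data.List.Relation.Unary.AllPairs using ([]; _∷_)
open import Data.List.Relation.Unary.Any using (here; there)
open import Data.List.Relation.Unary.Unique.Propositional using (Unique)
import Data.List.Relation.Unary.Unique.Propositional.Properties as Uniqueₚ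
open import Data.Maybe using (Maybe) renaming (map to map-maybe)
open import Data.Nat using (ℕ; zero; suc; _+_; _*_; _∸_; _/_; _%_; _<_; _≤_; z≤n; s≤s;
  _<ᵇ_; _≟_; _≤?_; _<?_; allUpTo?; >-nonZero; >-nonZero⁻¹; nonTrivial⇒n>1)
open import Data.List.Membership.DecPropositional _≟_ using (_∈?_)
open import Data.Nat.Coprimality using (Coprime; coprime-Bézout; coprime-divisor)
open import Data.Nat.Divisibility using (_∣_; _∣?_; divides)
import Data.Nat.Divisibility as Div
open import Data.Nat.DivMod using (m≡m%n+[m/n]*n; m%n<n; [m+kn]%n≡m%n; m*n%n≡0)
open import Data.Nat.GCD using (module Bézout; gcd; gcd-greatest)
open import Data.Nat.Primality
  using (Prime; prime?; prime⇒irreducible; prime⇒nonTrivial; prime⇒nonZero; ¬prime[1])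
import Data.Nat.Properties as ℕₚ
open import Data.Nat.Tactic.RingSolver using () renaming (solve-∀ to ℕ-solve-∀)
open import Data.Product using (∃; _×_; _,_; proj₁; proj₂)
open import Data.Sum as Sum using (_⊎_; inj₁; inj₂; [_,_]′)
open import Function.Bundles using (_⇔_; mk⇔)
open import Relation.Binary.PropositionalEquality
  using (_≡_; refl; sym; trans; cong; cong₂; subst; subst₂; module ≡-Reasoning)
import Relation.Binary.Reasoning.Setoid as SetoidReasoning
open import Relation.Nullary using (¬_; yes; no; _×-dec_; _⊎-dec_; _→-dec_)
open import Relation.Nullary.Decidable using (from-yes) renaming (dec⇒maybe to decToMaybe)

-- `Ψ` is reached through list divisions over proper divisors, so every cyclotomic polynomial
-- involved must be shown to be an exact quotient. Φ₃q, Φ₃r, Φ_qr and Φ₃qr are never computed: each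
-- is the cofactor in a divisibility by a least common multiple. As ℤ[x] is not a Bézout domain,
-- these divisibilities rest on explicit Bézout identities, one for x^p - 1 and x^q - 1, one for
-- Φ₃(x^q) and Φ₃(x^r).
--
-- The thresholds 2q - 7 and 2q - 3 come from e = 2q - r. The case m = 3 means r ≤ k < 2q and m = 6
-- means 2r ≤ k < 2q + r, two intervals of length e, and absolute value 2 requires one particular
-- residue of k modulo 3. If q ≡ r ≡ 1 (mod 3), that residue belongs to the second point of the
-- interval, so it is missed exactly when e = 1; as e is odd and e ≡ 1 (mod 3), the alternative is e
-- ≥ 7. If q ≡ r ≡ 2 (mod 3), it belongs to the first point, and e ≡ 5 (mod 6).
--
-- The set V also restricts the index to k ≤ n - φ(n); an upper bound for φ(n) suffices to admit the
-- indices where the values are found.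

infix 4 _≈_
infix 8 ⊝_

-- Lists that differ by trailing zeros represent one polynomial, so `≡` is too fine. A record rather
-- than a function type, so that unification can recover p and q.
record _≈_ (p q : Poly) : Set where
  constructor ≈-of
  field at : ∀ k → coeff p k ≡ coeff q k
open _≈_

≈-refl : ∀ {p} → p ≈ p
≈-refl = ≈-of λ _ → refl

≈-reflexive : ∀ {p q} → p ≡ q → p ≈ q
≈-reflexive refl = ≈-refl

≈-sym : ∀ {p q} → p ≈ q → q ≈ p
≈-sym e = ≈-of λ k → sym (at e k)

≈-trans : ∀ {p q s} → p ≈ q → q ≈ s → p ≈ s
≈-trans e e′ = ≈-of λ k → trans (at e k) (at e′ k)

∷-cong : ∀ {a b p q} → a ≡ b → p ≈ q → a ∷ p ≈ b ∷ q
∷-cong e e′ = ≈-of λ { zero → e ; (suc k) → at e′ k }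

∷-≈[] : ∀ {a p} → a ≡ + 0 → p ≈ [] → a ∷ p ≈ []
∷-≈[] e e′ = ≈-of λ { zero → e ; (suc k) → at e′ k }

tail-≈[] : ∀ {a p} → a ∷ p ≈ [] → p ≈ []
tail-≈[] e = ≈-of λ k → at e (suc k)

⊝_ : Poly → Poly
⊝ p = scale -[1+ 0 ] p

-- The commutative ring of coefficient lists modulo trailing zeros.

coeff-⊕ : ∀ p q k → coeff (p ⊕ q) k ≡ coeff p k ℤ.+ coeff q k
coeff-⊕ []      q       k       = sym (ℤₚ.+-identityˡ _)
coeff-⊕ (a ∷ p) []      k       = sym (ℤₚ.+-identityʳ _)
coeff-⊕ (a ∷ p) (b ∷ q) zero    = refl
coeff-⊕ (a ∷ p) (b ∷ q) (suc k) = coeff-⊕ p q k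

coeff-scale : ∀ a p k → coeff (scale a p) k ≡ a ℤ.* coeff p k
coeff-scale a []      k       = sym (ℤₚ.*-zeroʳ a)
coeff-scale a (b ∷ p) zero    = refl
coeff-scale a (b ∷ p) (suc k) = coeff-scale a p k

⊕-cong : ∀ {p p′ q q′} → p ≈ p′ → q ≈ q′ → p ⊕ q ≈ p′ ⊕ q′
⊕-cong {p} {p′} {q} {q′} e e′ = ≈-of λ k →
  trans (coeff-⊕ p q k) (trans (cong₂ ℤ._+_ (at e k) (at e′ k)) (sym (coeff-⊕ p′ q′ k)))

scale-cong : ∀ a {p p′} → p ≈ p′ → scale a p ≈ scale a p′
scale-cong a {p} {p′} e = ≈-of λ k →
  trans (coeff-scale a p k) (trans (cong (a ℤ.*_) (at e k)) (sym (coeff-scale a p′ k)))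

⊕-comm : ∀ p q → p ⊕ q ≈ q ⊕ p
⊕-comm p q = ≈-of λ k →
  trans (coeff-⊕ p q k) (trans (ℤₚ.+-comm (coeff p k) _) (sym (coeff-⊕ q p k)))

⊕-assoc : ∀ p q s → (p ⊕ q) ⊕ s ≈ p ⊕ (q ⊕ s)
⊕-assoc p q s = ≈-of λ k → begin
  coeff (p ⊕ q ⊕ s) k                   ≡⟨ coeff-⊕ (p ⊕ q) s k ⟩
  coeff (p ⊕ q) k ℤ.+ coeff s k         ≡⟨ cong (ℤ._+ coeff s k) (coeff-⊕ p q k) ⟩
  coeff p k ℤ.+ coeff q k ℤ.+ coeff s k ≡⟨ ℤₚ.+-assoc (coeff p k) _ _ ⟩
  coeff p k ℤ.+ (coeff q k ℤ.+ coeff s k) ≡⟨ cong (ℤ._+_ (coeff p k)) (coeff-⊕ q s k) ⟨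
  coeff p k ℤ.+ coeff (q ⊕ s) k         ≡⟨ coeff-⊕ p (q ⊕ s) k ⟨
  coeff (p ⊕ (q ⊕ s)) k                 ∎
  where open ≡-Reasoning

⊕-identityʳ : ∀ p → p ⊕ [] ≈ p
⊕-identityʳ p = ⊕-comm p []

⊕-inverseˡ : ∀ p → ⊝ p ⊕ p ≈ []
⊕-inverseˡ p = ≈-of λ k →
  trans (coeff-⊕ (⊝ p) p k) (trans (cong (ℤ._+ coeff p k) (trans (coeff-scale -[1+ 0 ] p k) (ℤₚ.-1*i≡-i (coeff p k))))
        (ℤₚ.+-inverseˡ (coeff p k)))

scale-⊕ : ∀ a p q → scale a (p ⊕ q) ≈ scale a p ⊕ scale a q
scale-⊕ a p q = ≈-of λ k → begin
  coeff (scale a (p ⊕ q)) k                 ≡⟨ coeff-scale a (p ⊕ q) k ⟩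
  a ℤ.* coeff (p ⊕ q) k                     ≡⟨ cong (a ℤ.*_) (coeff-⊕ p q k) ⟩
  a ℤ.* (coeff p k ℤ.+ coeff q k)           ≡⟨ ℤₚ.*-distribˡ-+ a (coeff p k) _ ⟩
  a ℤ.* coeff p k ℤ.+ a ℤ.* coeff q k       ≡⟨ cong₂ ℤ._+_ (coeff-scale a p k) (coeff-scale a q k) ⟨
  coeff (scale a p) k ℤ.+ coeff (scale a q) k ≡⟨ coeff-⊕ (scale a p) (scale a q) k ⟨
  coeff (scale a p ⊕ scale a q) k           ∎
  where open ≡-Reasoning

scale-0 : ∀ p → scale (+ 0) p ≈ []
scale-0 p = ≈-of λ k → coeff-scale (+ 0) p k

scale-1 : ∀ p → scale (+ 1) p ≈ p
scale-1 p = ≈-of λ k → trans (coeff-scale (+ 1) p k) (ℤₚ.*-identityˡ _)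

scale-scale : ∀ a b p → scale a (scale b p) ≈ scale (a ℤ.* b) p
scale-scale a b p = ≈-of λ k →
  trans (coeff-scale a (scale b p) k) (trans (cong (a ℤ.*_) (coeff-scale b p k))
  (trans (sym (ℤₚ.*-assoc a b _)) (sym (coeff-scale (a ℤ.* b) p k))))

⊕-medial : ∀ p q s t → (p ⊕ q) ⊕ (s ⊕ t) ≈ (p ⊕ s) ⊕ (q ⊕ t)
⊕-medial p q s t = ≈-trans (⊕-assoc p q _)
  (≈-trans (⊕-cong (≈-refl {p}) (≈-trans (≈-sym (⊕-assoc q s t))
             (≈-trans (⊕-cong (⊕-comm q s) ≈-refl) (⊕-assoc s q t))))
    (≈-sym (⊕-assoc p s _)))

⊗-congʳ : ∀ p {q q′} → q ≈ q′ → p ⊗ q ≈ p ⊗ q′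
⊗-congʳ []      e = ≈-refl
⊗-congʳ (a ∷ p) e = ⊕-cong (scale-cong a e) (∷-cong refl (⊗-congʳ p e))

⊗-zeroʳ : ∀ p → p ⊗ [] ≈ []
⊗-zeroʳ []      = ≈-refl
⊗-zeroʳ (a ∷ p) = ∷-≈[] refl (⊗-zeroʳ p)

-- `_⊗_` recurses on its left factor; this is the mirror recursion on the right factor, from which
-- commutativity follows by induction.
⊗-∷ʳ : ∀ p b q → p ⊗ (b ∷ q) ≈ scale b p ⊕ (+ 0 ∷ p ⊗ q)
⊗-∷ʳ []      b q = ≈-sym (∷-≈[] refl ≈-refl)
⊗-∷ʳ (a ∷ p) b q = ∷-cong (cong (ℤ._+ + 0) (ℤₚ.*-comm a b))
  (≈-trans (⊕-cong (≈-refl {scale a q}) (⊗-∷ʳ p b q))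
  (≈-trans (≈-sym (⊕-assoc (scale a q) _ _))
  (≈-trans (⊕-cong (⊕-comm (scale a q) (scale b p)) ≈-refl)
           (⊕-assoc (scale b p) _ _))))

⊗-comm : ∀ p q → p ⊗ q ≈ q ⊗ p
⊗-comm []      q = ≈-sym (⊗-zeroʳ q)
⊗-comm (a ∷ p) q = ≈-trans (⊕-cong ≈-refl (∷-cong refl (⊗-comm p q))) (≈-sym (⊗-∷ʳ q a p))

⊗-cong : ∀ {p p′ q q′} → p ≈ p′ → q ≈ q′ → p ⊗ q ≈ p′ ⊗ q′
⊗-cong {p} {p′} {q} {q′} e e′ = ≈-trans (⊗-congʳ p e′)
  (≈-trans (⊗-comm p q′) (≈-trans (⊗-congʳ q′ e) (⊗-comm q′ p′)))

⊗-distribˡ : ∀ p q s → p ⊗ (q ⊕ s) ≈ p ⊗ q ⊕ p ⊗ s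
⊗-distribˡ []      q s = ≈-refl
⊗-distribˡ (a ∷ p) q s = ≈-trans (⊕-cong (scale-⊕ a q s) (∷-cong refl (⊗-distribˡ p q s)))
  (⊕-medial (scale a q) (scale a s) (+ 0 ∷ p ⊗ q) (+ 0 ∷ p ⊗ s))

⊗-distribʳ : ∀ p q s → (q ⊕ s) ⊗ p ≈ q ⊗ p ⊕ s ⊗ p
⊗-distribʳ p q s = ≈-trans (⊗-comm (q ⊕ s) p)
  (≈-trans (⊗-distribˡ p q s) (⊕-cong (⊗-comm p q) (⊗-comm p s)))

scale-⊗ : ∀ a p q → scale a p ⊗ q ≈ scale a (p ⊗ q)
scale-⊗ a []      q = ≈-refl
scale-⊗ a (b ∷ p) q = ≈-trans
  (⊕-cong (≈-sym (scale-scale a b q)) (∷-cong (sym (ℤₚ.*-zeroʳ a)) (scale-⊗ a p q)))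
  (≈-sym (scale-⊕ a (scale b q) (+ 0 ∷ p ⊗ q)))

0∷-⊗ : ∀ p q → (+ 0 ∷ p) ⊗ q ≈ + 0 ∷ p ⊗ q
0∷-⊗ p q = ⊕-cong (scale-0 q) ≈-refl

⊗-assoc : ∀ p q s → (p ⊗ q) ⊗ s ≈ p ⊗ (q ⊗ s)
⊗-assoc []      q s = ≈-refl
⊗-assoc (a ∷ p) q s = ≈-trans (⊗-distribʳ s (scale a q) (+ 0 ∷ p ⊗ q))
  (⊕-cong (scale-⊗ a q s) (≈-trans (0∷-⊗ (p ⊗ q) s) (∷-cong refl (⊗-assoc p q s))))

const-⊗ : ∀ a p → [ a ] ⊗ p ≈ scale a p
const-⊗ a p = ≈-trans (⊕-cong ≈-refl (∷-≈[] refl ≈-refl)) (⊕-identityʳ _)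

⊗-identityˡ : ∀ p → [ + 1 ] ⊗ p ≈ p
⊗-identityˡ p = ≈-trans (const-⊗ (+ 1) p) (scale-1 p)

⊗-identityʳ : ∀ p → p ⊗ [ + 1 ] ≈ p
⊗-identityʳ p = ≈-trans (⊗-comm p _) (⊗-identityˡ p)

polyRing : CommutativeRing _ _
polyRing = record
  { Carrier = Poly ; _≈_ = _≈_ ; _+_ = _⊕_ ; _*_ = _⊗_ ; -_ = ⊝_ ; 0# = [] ; 1# = [ + 1 ]
  ; isCommutativeRing = record
    { isRing = record
      { +-isAbelianGroup = record
        { isGroup = record
          { isMonoid = record
            { isSemigroup = record
              { isMagma = record
                { isEquivalence = record { refl = ≈-refl ; sym = ≈-sym ; trans = ≈-trans }
                ; ∙-cong = ⊕-cong }
              ; assoc = ⊕-assoc }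
            ; identity = (λ _ → ≈-refl) , ⊕-identityʳ }
          ; inverse = ⊕-inverseˡ , (λ p → ≈-trans (⊕-comm p _) (⊕-inverseˡ p))
          ; ⁻¹-cong = scale-cong -[1+ 0 ] }
        ; comm = ⊕-comm }
      ; *-cong = ⊗-cong
      ; *-assoc = ⊗-assoc
      ; *-identity = ⊗-identityˡ , ⊗-identityʳ
      ; distrib = ⊗-distribˡ , ⊗-distribʳ }
    ; *-comm = ⊗-comm } }

module ≈-Reasoning = SetoidReasoning (CommutativeRing.setoid polyRing)

-- Lets the ring solver compute with integer coefficients. The embedded zero `[ + 0 ]` and the
-- ring's zero `[]` agree only up to `≈`.
constants : ACR._-Raw-AlmostCommutative⟶_ (CommutativeRing.rawRing ℤₚ.+-*-commutativeRing) (ACR.fromCommutativeRing polyRing)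
constants = record
  { ⟦_⟧ = [_]
  ; +-homo = λ _ _ → ≈-refl
  ; *-homo = λ a b → ∷-cong (sym (ℤₚ.+-identityʳ (a ℤ.* b))) ≈-refl
  ; -‿homo = λ a → ∷-cong (sym (ℤₚ.-1*i≡-i a)) ≈-refl
  ; 0-homo = ∷-≈[] refl ≈-refl
  ; 1-homo = ≈-refl }

constants-≟ : ∀ a b → Maybe ([ a ] ≈ [ b ])
constants-≟ a b = map-maybe (λ e → ≈-reflexive (cong [_] e)) (decToMaybe (a ℤ.≟ b))

module Solve = RingSolver (CommutativeRing.rawRing ℤₚ.+-*-commutativeRing) (ACR.fromCommutativeRing polyRing) constants constants-≟

open ≈-Reasoning
open Solve using (solve; _:+_; _:*_; _:-_; :-_; _:=_; con)

-- The binomials X^n - 1, geometric sums, cancellation and least common multiples.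

infixl 6 _⊖_
_⊖_ : Poly → Poly → Poly
p ⊖ q = p ⊕ ⊝ q

one : Poly
one = [ + 1 ]

X^ : ℕ → Poly
X^ zero    = one
X^ (suc n) = + 0 ∷ X^ n

Δ : ℕ → Poly
Δ n = X^ n ⊖ one

-- Horner form of (X^(km) - 1)/(X^m - 1). Two shapes matter: `geo 1 p` is Φ_p for a prime p, and
-- `geo m 3` is Φ₃(X^m), which equals Φ₃ Φ₃m when m is a prime other than 3.
geo : ℕ → ℕ → Poly
geo m zero    = []
geo m (suc k) = one ⊕ X^ m ⊗ geo m k

X^-+ : ∀ m n → X^ (m + n) ≈ X^ m ⊗ X^ n
X^-+ zero    n = ≈-sym (⊗-identityˡ _)
X^-+ (suc m) n = ≈-trans (∷-cong refl (X^-+ m n)) (≈-sym (0∷-⊗ (X^ m) (X^ n)))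

xPowMinusOne-Δ : ∀ n → xPowMinusOne n ≈ Δ n
xPowMinusOne-Δ zero    = ≈-of λ { zero → refl ; (suc k) → refl }
xPowMinusOne-Δ (suc n) = ∷-cong refl (≈-trans (tail n) (≈-sym (⊕-identityʳ (X^ n))))
  where
  tail : ∀ n → replicate n (+ 0) ++ one ≈ X^ n
  tail zero    = ≈-refl
  tail (suc n) = ∷-cong refl (tail n)

Δ-+ : ∀ m n → Δ (m + n) ≈ X^ m ⊗ Δ n ⊕ Δ m
Δ-+ m n = begin
  X^ (m + n) ⊖ one     ≈⟨ ⊕-cong (X^-+ m n) ≈-refl ⟩
  X^ m ⊗ X^ n ⊖ one    ≈⟨ solve 2 (λ x y → x :* y :- con (+ 1) := x :* (y :- con (+ 1)) :+ (x :- con (+ 1))) ≈-refl (X^ m) (X^ n) ⟩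
  X^ m ⊗ Δ n ⊕ Δ m     ∎

Δ-* : ∀ m k → Δ (k * m) ≈ Δ m ⊗ geo m k
Δ-* m zero    = ≈-trans (⊕-inverseʳ one) (≈-sym (⊗-zeroʳ (Δ m)))
  where ⊕-inverseʳ = CommutativeRing.-‿inverseʳ polyRing
Δ-* m (suc k) = begin
  Δ (m + k * m)                        ≈⟨ Δ-+ m (k * m) ⟩
  X^ m ⊗ Δ (k * m) ⊕ Δ m               ≈⟨ ⊕-cong (⊗-congʳ (X^ m) (Δ-* m k)) ≈-refl ⟩
  X^ m ⊗ (Δ m ⊗ geo m k) ⊕ Δ m         ≈⟨ solve 3 (λ x d g → x :* (d :* g) :+ d := d :* (con (+ 1) :+ x :* g)) ≈-refl (X^ m) (Δ m) (geo m k) ⟩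
  Δ m ⊗ geo m (suc k)                  ∎

⊖-cong : ∀ {p p′ q q′} → p ≈ p′ → q ≈ q′ → p ⊖ q ≈ p′ ⊖ q′
⊖-cong e e′ = ⊕-cong e (scale-cong -[1+ 0 ] e′)

⊖≈[]⇒≈ : ∀ {p q} → p ⊖ q ≈ [] → p ≈ q
⊖≈[]⇒≈ {p} {q} e = begin
  p           ≈⟨ solve 2 (λ p q → p := (p :- q) :+ q) ≈-refl p q ⟩
  p ⊖ q ⊕ q   ≈⟨ ⊕-cong e ≈-refl ⟩
  q           ∎

≈⇒⊖≈[] : ∀ {p q} → p ≈ q → p ⊖ q ≈ []
≈⇒⊖≈[] {p} {q} e = ≈-trans (⊖-cong e (≈-refl {q})) (CommutativeRing.-‿inverseʳ polyRing q)

-- Cancellation from the bottom: the constant term of d is a unit.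
⊗-zero-unit : ∀ {d₀ d} → ℤ.∣ d₀ ∣ ≡ 1 → ∀ p → (d₀ ∷ d) ⊗ p ≈ [] → p ≈ []
⊗-zero-unit u [] e = ≈-refl
⊗-zero-unit {d₀} {d} u (a ∷ p) e = ∷-≈[] a≡0 (⊗-zero-unit {d₀} {d} u p (tail-≈[] (≈-trans (≈-sym shifted) e)))
  where
  d₀a≡0 : d₀ ℤ.* a ≡ + 0
  d₀a≡0 = trans (sym (ℤₚ.+-identityʳ _)) (at e 0)
  a≡0 : a ≡ + 0
  a≡0 = ℤₚ.∣i∣≡0⇒i≡0 (trans (sym (ℕₚ.*-identityˡ _))
          (trans (cong (_* ℤ.∣ a ∣) (sym u)) (trans (sym (ℤₚ.abs-* d₀ a)) (cong ℤ.∣_∣ d₀a≡0))))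
  shifted : (d₀ ∷ d) ⊗ (a ∷ p) ≈ + 0 ∷ (d₀ ∷ d) ⊗ p
  shifted = ≈-trans (⊗-comm (d₀ ∷ d) (a ∷ p)) (≈-trans
    (⊕-cong (≈-trans (≈-reflexive (cong (λ z → scale z (d₀ ∷ d)) a≡0)) (scale-0 (d₀ ∷ d))) ≈-refl)
    (∷-cong refl (⊗-comm p (d₀ ∷ d))))

Cancellable : Poly → Set
Cancellable d = ∀ p → d ⊗ p ≈ [] → p ≈ []

-- The factors cancelled through `⊗-cancelˡ` are X^n - 1 with n ≥ 1 and 1 + X + X², whose constant
-- terms are units; this stands in for ℤ[X] being an integral domain.
unit-cancellable : ∀ d → ℤ.∣ coeff d 0 ∣ ≡ 1 → Cancellable d
unit-cancellable (d₀ ∷ d) u = ⊗-zero-unit {d₀} {d} u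

⊗-cancelˡ : ∀ {d p q} → Cancellable d → d ⊗ p ≈ d ⊗ q → p ≈ q
⊗-cancelˡ {d} {p} {q} cd e = ⊖≈[]⇒≈ (cd (p ⊖ q) (begin
  d ⊗ (p ⊖ q)      ≈⟨ solve 3 (λ d p q → d :* (p :- q) := d :* p :- d :* q) ≈-refl d p q ⟩
  d ⊗ p ⊖ d ⊗ q    ≈⟨ ≈⇒⊖≈[] e ⟩
  []               ∎))

infix 4 _∣ₚ_
_∣ₚ_ : Poly → Poly → Set
d ∣ₚ p = ∃ λ h → p ≈ d ⊗ h

-- By the Bézout hypothesis D is gcd (A , B), so that D a b is lcm (A , B).
lcm-∣ : ∀ {D a b A B H U V} → Cancellable D → A ≈ D ⊗ a → B ≈ D ⊗ b →
  U ⊗ A ⊕ V ⊗ B ≈ D → A ∣ₚ H → B ∣ₚ H → D ⊗ a ⊗ b ∣ₚ H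
lcm-∣ {D} {a} {b} {A} {B} {H} {U} {V} cD Aeq Beq bez (hA , HA) (hB , HB) =
  U ⊗ hB ⊕ V ⊗ hA , ⊗-cancelˡ {D} cD (begin
    D ⊗ H                                   ≈⟨ ⊗-cong bez (≈-refl {H}) ⟨
    (U ⊗ A ⊕ V ⊗ B) ⊗ H                     ≈⟨ solve 5 (λ u a v b h → (u :* a :+ v :* b) :* h := u :* a :* h :+ v :* b :* h) ≈-refl U A V B H ⟩
    U ⊗ A ⊗ H ⊕ V ⊗ B ⊗ H                   ≈⟨ ⊕-cong (⊗-cong (⊗-congʳ U Aeq) (≈-trans HB (⊗-cong Beq ≈-refl)))
                                                      (⊗-cong (⊗-congʳ V Beq) (≈-trans HA (⊗-cong Aeq ≈-refl))) ⟩
    U ⊗ (D ⊗ a) ⊗ (D ⊗ b ⊗ hB) ⊕ V ⊗ (D ⊗ b) ⊗ (D ⊗ a ⊗ hA)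
      ≈⟨ solve 7 (λ d a b u v x y → u :* (d :* a) :* (d :* b :* x) :+ v :* (d :* b) :* (d :* a :* y)
                    := d :* (d :* a :* b :* (u :* x :+ v :* y))) ≈-refl D a b U V hB hA ⟩
    D ⊗ (D ⊗ a ⊗ b ⊗ (U ⊗ hB ⊕ V ⊗ hA))     ∎)

-- Monic lists and the correctness of long division.

data Monic : ℕ → Poly → Set where
  lead : Monic 0 one
  step : ∀ {n a p} → Monic n p → Monic (suc n) (a ∷ p)

length-scale : ∀ a p → length (scale a p) ≡ length p
length-scale a p = Listₚ.length-map (a ℤ.*_) p

Monic-length : ∀ {n p} → Monic n p → length p ≡ suc n
Monic-length lead     = refl
Monic-length (step m) = cong suc (Monic-length m)

Monic-⊕ : ∀ {n p} z → Monic n p → length z ≤ n → Monic n (z ⊕ p)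
Monic-⊕ []      m        l       = m
Monic-⊕ (a ∷ z) (step m) (s≤s l) = step (Monic-⊕ z m l)

-- An equality of lists, because `Monic` speaks of the list itself: `quotMonic` reads lengths, and
-- `≈` would not preserve the absence of trailing zeros. It holds since a monic list is nonempty.
one-⊗ : ∀ {n p} → Monic n p → one ⊗ p ≡ p
one-⊗ lead             = refl
one-⊗ (step {a = a} m) = cong₂ _∷_ (trans (ℤₚ.+-identityʳ _) (ℤₚ.*-identityˡ a)) (scale-⊕[] m)
  where
  scale-⊕[] : ∀ {n p} → Monic n p → scale (+ 1) p ⊕ [] ≡ p
  scale-⊕[] lead             = refl
  scale-⊕[] (step {a = a} {p = p} m) = cong₂ _∷_ (ℤₚ.*-identityˡ a)
    (trans (Listₚ.map-cong ℤₚ.*-identityˡ p) (Listₚ.map-id p))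

Monic-⊗ : ∀ {m n p q} → Monic m p → Monic n q → Monic (m + n) (p ⊗ q)
Monic-⊗ lead                         mq = subst (Monic _) (sym (one-⊗ mq)) mq
Monic-⊗ {n = n} {q = q} (step {n = m} {a = a} mp) mq = Monic-⊕ (scale a q) (step (Monic-⊗ mp mq))
  (subst (_≤ suc (m + n)) (sym (trans (length-scale a q) (Monic-length mq))) (s≤s (ℕₚ.m≤n+m n m)))

Monic-∷ʳ : ∀ p → Monic (length p) (p ∷ʳ + 1)
Monic-∷ʳ []      = lead
Monic-∷ʳ (a ∷ p) = step (Monic-∷ʳ p)

Monic-reverse : ∀ {n p} → Monic n p → ∃ λ as → (reverse p ≡ + 1 ∷ as) × (length as ≡ n)
Monic-reverse lead = [] , refl , refl
Monic-reverse (step {a = a} {p = p} m) with Monic-reverse m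
... | as , e , l = as ∷ʳ a , trans (Listₚ.unfold-reverse a p) (cong (_∷ʳ a) e) ,
                   trans (Listₚ.length-++ as) (trans (ℕₚ.+-comm _ 1) (cong suc l))

coeff-length≤ : ∀ p {k} → length p ≤ k → coeff p k ≡ + 0
coeff-length≤ []      l       = refl
coeff-length≤ (a ∷ p) (s≤s l) = coeff-length≤ p l

Monic-coeff : ∀ {n p} → Monic n p → coeff p n ≡ + 1
Monic-coeff lead     = refl
Monic-coeff (step m) = Monic-coeff m

-- Cancellation from the top, by comparing degrees.
⊗-zero-degree : ∀ {n b} → Monic n b → ∀ p → (∀ k → n ≤ k → coeff (p ⊗ b) k ≡ + 0) → p ≈ []
⊗-zero-degree mb []      h = ≈-refl
⊗-zero-degree {n} {b} mb (a ∷ p) h = ∷-≈[] a≡0 p≈[]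
  where
  split : ∀ k → coeff ((a ∷ p) ⊗ b) k ≡ a ℤ.* coeff b k ℤ.+ coeff (+ 0 ∷ p ⊗ b) k
  split k = trans (coeff-⊕ (scale a b) _ k) (cong (ℤ._+ coeff (+ 0 ∷ p ⊗ b) k) (coeff-scale a b k))
  p≈[] : p ≈ []
  p≈[] = ⊗-zero-degree mb p λ k n≤k → trans (sym (ℤₚ.+-identityˡ _))
    (trans (cong (ℤ._+ coeff (p ⊗ b) k) (sym (trans
        (cong (a ℤ.*_) (coeff-length≤ b (subst (_≤ suc k) (sym (Monic-length mb)) (s≤s n≤k)))) (ℤₚ.*-zeroʳ a))))
      (trans (sym (split (suc k))) (h (suc k) (ℕₚ.m≤n⇒m≤1+n n≤k))))
  a≡0 : a ≡ + 0
  a≡0 = trans (sym (trans (cong₂ ℤ._+_ (trans (cong (a ℤ.*_) (Monic-coeff mb)) (ℤₚ.*-identityʳ a))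
               (at (∷-≈[] refl (⊗-cong p≈[] (≈-refl {b}))) n)) (ℤₚ.+-identityʳ a)))
          (trans (sym (split n)) (h n ℕₚ.≤-refl))

-- The division helpers of Defs are private; unification names them.
mutual
  divide : ℕ → List ℤ → List ℤ → List ℤ
  divide = _

  quotMonic-divide : ∀ a b → quotMonic a b ≡ reverse (divide (length a) (reverse a) (reverse b))
  quotMonic-divide a b with length a | reverse a | reverse b
  ... | n | as | bs with reverse {A = ℤ}
  ... | rev = refl

mutual
  subtract : List ℤ → List ℤ → List ℤ
  subtract = _

  divide-step : ∀ f a as b bs → divide (suc f) (a ∷ as) (b ∷ bs) ≡
    (if length (a ∷ as) <ᵇ length (b ∷ bs) then [] else a ∷ divide f (subtract as (scale a bs)) (b ∷ bs))
  -- Abstracting the scaled divisor leaves the unknown `subtract` applied to the variables `as` and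
  -- `cs`, so that unification can determine it.
  divide-step f a as b bs with length (a ∷ as) <ᵇ length (b ∷ bs) | scale a bs
  ... | true  | cs = refl
  ... | false | cs = refl

length-subtract : ∀ as cs → length cs ≤ length as → length (subtract as cs) ≡ length as
length-subtract []       []       l       = refl
length-subtract (a ∷ as) []       l       = refl
length-subtract (a ∷ as) (c ∷ cs) (s≤s l) = cong suc (length-subtract as cs l)

∷ʳ-≈ : ∀ p a → p ∷ʳ a ≈ p ⊕ [ a ] ⊗ X^ (length p)
∷ʳ-≈ []      a = ∷-cong (sym (trans (ℤₚ.+-identityʳ _) (ℤₚ.*-identityʳ a))) ≈-refl
∷ʳ-≈ (b ∷ p) a = ≈-trans (∷-cong (sym (ℤₚ.+-identityʳ b)) (∷ʳ-≈ p a))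
  (⊕-cong (≈-refl {b ∷ p}) (≈-sym (≈-trans (⊗-comm [ a ] _) (≈-trans (0∷-⊗ (X^ (length p)) [ a ])
     (∷-cong refl (⊗-comm (X^ (length p)) [ a ]))))))

reverse-∷ : ∀ a as → reverse (a ∷ as) ≈ reverse as ⊕ [ a ] ⊗ X^ (length as)
reverse-∷ a as = begin
  reverse (a ∷ as)                             ≡⟨ Listₚ.unfold-reverse a as ⟩
  reverse as ∷ʳ a                              ≈⟨ ∷ʳ-≈ (reverse as) a ⟩
  reverse as ⊕ [ a ] ⊗ X^ (length (reverse as)) ≡⟨ cong (λ l → reverse as ⊕ [ a ] ⊗ X^ l) (Listₚ.length-reverse as) ⟩
  reverse as ⊕ [ a ] ⊗ X^ (length as)          ∎

-- Lists with the highest degree first are aligned at their leading entries; once reversed, the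
-- shorter one is displaced by the difference e of the lengths.
reverse-subtract : ∀ as cs e → length as ≡ e + length cs →
  reverse (subtract as cs) ≈ reverse as ⊖ X^ e ⊗ reverse cs
reverse-subtract []       []       e l = ≈-sym (≈-trans (scale-cong -[1+ 0 ] (⊗-zeroʳ (X^ e))) ≈-refl)
reverse-subtract (a ∷ as) []       e l = ≈-sym
  (≈-trans (⊖-cong (≈-refl {reverse (a ∷ as)}) (⊗-zeroʳ (X^ e))) (⊕-identityʳ _))
reverse-subtract []       (c ∷ cs) e l with () ← trans l (ℕₚ.+-suc e _)
reverse-subtract (a ∷ as) (c ∷ cs) e l = begin
  reverse ((a ℤ.- c) ∷ subtract as cs)
    ≈⟨ reverse-∷ (a ℤ.- c) (subtract as cs) ⟩
  reverse (subtract as cs) ⊕ [ a ℤ.- c ] ⊗ X^ (length (subtract as cs))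
    ≈⟨ ⊕-cong (reverse-subtract as cs e l′) (⊗-cong (∷-cong (cong (ℤ._+_ a) (sym (ℤₚ.-1*i≡-i c))) (≈-refl {[]}))
         (≈-trans (≈-reflexive (cong X^ (trans (length-subtract as cs cs≤as) l′))) (X^-+ e (length cs)))) ⟩
  (reverse as ⊖ X^ e ⊗ reverse cs) ⊕ ([ a ] ⊖ [ c ]) ⊗ (X^ e ⊗ X^ (length cs))
    ≈⟨ solve 6 (λ p x s a c y → (p :- x :* s) :+ (a :- c) :* (x :* y) := (p :+ a :* (x :* y)) :- x :* (s :+ c :* y)) ≈-refl
         (reverse as) (X^ e) (reverse cs) [ a ] [ c ] (X^ (length cs)) ⟩
  (reverse as ⊕ [ a ] ⊗ (X^ e ⊗ X^ (length cs))) ⊖ X^ e ⊗ (reverse cs ⊕ [ c ] ⊗ X^ (length cs))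
    ≈⟨ ⊖-cong (⊕-cong (≈-refl {reverse as}) (⊗-congʳ [ a ] (≈-trans (≈-sym (X^-+ e (length cs))) (≈-reflexive (cong X^ (sym l′))))))
              (⊗-congʳ (X^ e) (≈-sym (reverse-∷ c cs))) ⟩
  (reverse as ⊕ [ a ] ⊗ X^ (length as)) ⊖ X^ e ⊗ reverse (c ∷ cs)
    ≈⟨ ⊕-cong (reverse-∷ a as) ≈-refl ⟨
  reverse (a ∷ as) ⊖ X^ e ⊗ reverse (c ∷ cs) ∎
  where
  l′ : length as ≡ e + length cs
  l′ = ℕₚ.suc-injective (trans l (ℕₚ.+-suc e _))
  cs≤as : length cs ≤ length as
  cs≤as = subst (length cs ≤_) (sym l′) (ℕₚ.m≤n+m _ e)

reverse-scale : ∀ a p → reverse (scale a p) ≈ [ a ] ⊗ reverse p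
reverse-scale a p = ≈-trans (≈-reflexive (sym (Listₚ.reverse-map (a ℤ.*_) p))) (≈-sym (const-⊗ a (reverse p)))

-- `bs` is the monic divisor without its leading 1, so `small` says that the remainder has smaller
-- degree than the divisor. `length-quot` tells the induction at which power of X the next leading
-- entry of the quotient belongs.
record Division (as bs : List ℤ) (quotient : List ℤ) : Set where
  field
    remainder   : List ℤ
    small       : length remainder ≤ length bs
    length-quot : length quotient ≡ length as ∸ length bs
    division    : reverse as ≈ reverse quotient ⊗ reverse (+ 1 ∷ bs) ⊕ reverse remainder

<ᵇ-true : ∀ {m n} → m < n → (m <ᵇ n) ≡ true
<ᵇ-true {m} {n} h with m <ᵇ n | ℕₚ.<⇒<ᵇ h
... | true | _ = refl

<ᵇ-false : ∀ {m n} → n ≤ m → (m <ᵇ n) ≡ false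
<ᵇ-false {m} {n} h with m <ᵇ n in e
... | false = refl
... | true  = ⊥-elim (ℕₚ.≤⇒≯ h (ℕₚ.<ᵇ⇒< m n (subst T (sym e) _)))

-- A division step removes a X^e times the divisor, where a is the leading entry and e the excess
-- length. The leading terms cancel because the divisor is monic, and the induction hypothesis
-- divides what is left.
divide-correct : ∀ f as bs → length as ≤ f → Division as bs (divide f as (+ 1 ∷ bs))
divide-correct zero    []       bs l = record
  { remainder = [] ; small = z≤n ; length-quot = sym (ℕₚ.0∸n≡0 (length bs)) ; division = ≈-refl }
divide-correct (suc f) []       bs l = record
  { remainder = [] ; small = z≤n ; length-quot = sym (ℕₚ.0∸n≡0 (length bs)) ; division = ≈-refl }
divide-correct (suc f) (a ∷ as) bs (s≤s l) with length as <? length bs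
... | yes lt = subst (Division (a ∷ as) bs)
  (sym (trans (divide-step f a as (+ 1) bs) (cong (λ t → if t then [] else (a ∷ divide f (subtract as (scale a bs)) (+ 1 ∷ bs))) (<ᵇ-true (s≤s lt))))) (record
  { remainder = a ∷ as ; small = lt ; length-quot = sym (ℕₚ.m≤n⇒m∸n≡0 lt) ; division = ≈-refl })
... | no ≮ = subst (Division (a ∷ as) bs)
  (sym (trans (divide-step f a as (+ 1) bs) (cong (λ t → if t then [] else (a ∷ divide f (subtract as (scale a bs)) (+ 1 ∷ bs))) (<ᵇ-false (s≤s ge))))) (record
  { remainder = IH.remainder
  ; small = IH.small
  ; length-quot = trans (cong suc length-q) (sym (ℕₚ.+-∸-assoc 1 ge))
  ; division = begin
      reverse (a ∷ as)
        ≈⟨ reverse-∷ a as ⟩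
      reverse as ⊕ [ a ] ⊗ X^ (length as)
        ≈⟨ ⊕-cong as-eq (⊗-congʳ [ a ] (≈-trans (≈-reflexive (cong X^ as-length)) (X^-+ e (length bs)))) ⟩
      (q ⊗ B ⊕ r ⊕ X^ e ⊗ ([ a ] ⊗ b)) ⊕ [ a ] ⊗ (X^ e ⊗ X^ (length bs))
        ≈⟨ ⊕-cong (⊕-cong (⊕-cong (⊗-congʳ q B-eq) (≈-refl {r})) (≈-refl {X^ e ⊗ ([ a ] ⊗ b)})) ≈-refl ⟩
      (q ⊗ (b ⊕ one ⊗ X^ (length bs)) ⊕ r ⊕ X^ e ⊗ ([ a ] ⊗ b)) ⊕ [ a ] ⊗ (X^ e ⊗ X^ (length bs))
        ≈⟨ solve 6 (λ q b y r x a → (q :* (b :+ con (+ 1) :* y) :+ r :+ x :* (a :* b)) :+ a :* (x :* y)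
              := (q :+ a :* x) :* (b :+ con (+ 1) :* y) :+ r) ≈-refl q b (X^ (length bs)) r (X^ e) [ a ] ⟩
      (q ⊕ [ a ] ⊗ X^ e) ⊗ (b ⊕ one ⊗ X^ (length bs)) ⊕ r
        ≈⟨ ⊕-cong (⊗-cong (≈-sym (≈-trans (reverse-∷ a Q) (≈-reflexive (cong (λ n → q ⊕ [ a ] ⊗ X^ n) length-q)))) (≈-sym B-eq)) (≈-refl {r}) ⟩
      reverse (a ∷ Q) ⊗ B ⊕ r ∎ })
  where
  ge : length bs ≤ length as
  ge = ℕₚ.≮⇒≥ ≮
  e = length as ∸ length bs
  as′ = subtract as (scale a bs)
  length-as′ : length as′ ≡ length as
  length-as′ = length-subtract as (scale a bs) (subst (_≤ length as) (sym (length-scale a bs)) ge)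
  module IH = Division (divide-correct f as′ bs (subst (_≤ f) (sym length-as′) l))
  Q = divide f as′ (+ 1 ∷ bs)
  q = reverse Q
  B = reverse (+ 1 ∷ bs)
  b = reverse bs
  r = reverse IH.remainder
  length-q : length Q ≡ e
  length-q = trans IH.length-quot (cong (_∸ length bs) length-as′)
  B-eq : B ≈ b ⊕ one ⊗ X^ (length bs)
  B-eq = reverse-∷ (+ 1) bs
  as-length : length as ≡ e + length bs
  as-length = sym (ℕₚ.m∸n+n≡m ge)
  as-eq : reverse as ≈ q ⊗ B ⊕ r ⊕ X^ e ⊗ ([ a ] ⊗ b)
  as-eq = begin
    reverse as
      ≈⟨ solve 2 (λ p s → p := p :- s :+ s) ≈-refl (reverse as) (X^ e ⊗ reverse (scale a bs)) ⟩
    reverse as ⊖ X^ e ⊗ reverse (scale a bs) ⊕ X^ e ⊗ reverse (scale a bs)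
      ≈⟨ ⊕-cong (≈-sym (reverse-subtract as (scale a bs) e (trans as-length (cong (_+_ e) (sym (length-scale a bs)))))) (⊗-congʳ (X^ e) (reverse-scale a bs)) ⟩
    reverse as′ ⊕ X^ e ⊗ ([ a ] ⊗ b)
      ≈⟨ ⊕-cong IH.division ≈-refl ⟩
    q ⊗ B ⊕ r ⊕ X^ e ⊗ ([ a ] ⊗ b) ∎

IsMonic : Poly → Set
IsMonic p = ∃ λ n → Monic n p

-- For the computed quotient Q, the product (K - Q) B is the remainder, of degree below that of B;
-- as B is monic, K = Q. The list `K` may carry trailing zeros, whereas the computed list is monic
-- because its leading entry is that of `A`.
quotMonic-exact : ∀ {A B} K → IsMonic A → IsMonic B → K ⊗ B ≈ A → IsMonic (quotMonic A B) × (quotMonic A B ≈ K)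
quotMonic-exact {A} {B} K (m , mA) (n , mB) KB≈A with Monic-reverse mA | Monic-reverse mB
... | as , rA , lA | bs , rB , lB = monic , ≈-trans (≈-reflexive quot≡) (≈-sym K≈Q)
  where
  as⁺ = + 1 ∷ as
  bs⁺ = + 1 ∷ bs
  Q = divide (suc m) as⁺ bs⁺
  quot≡ : quotMonic A B ≡ reverse Q
  quot≡ = trans (quotMonic-divide A B)
    (cong reverse (trans (cong (λ f → divide f (reverse A) (reverse B)) (Monic-length mA)) (cong₂ (divide (suc m)) rA rB)))
  open Division (divide-correct (suc m) as⁺ bs (ℕₚ.≤-reflexive (cong suc lA)))
  A≈ : A ≈ reverse Q ⊗ B ⊕ reverse remainder
  A≈ = ≈-trans (≈-reflexive (trans (sym (Listₚ.reverse-involutive A)) (cong reverse rA)))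
    (≈-trans division (⊕-cong (⊗-congʳ (reverse Q)
      (≈-reflexive (trans (cong reverse (sym rB)) (Listₚ.reverse-involutive B)))) ≈-refl))
  R≈ : (K ⊖ reverse Q) ⊗ B ≈ reverse remainder
  R≈ = begin
    (K ⊖ reverse Q) ⊗ B
      ≈⟨ solve 3 (λ k q b → (k :- q) :* b := k :* b :- q :* b) ≈-refl K (reverse Q) B ⟩
    K ⊗ B ⊖ reverse Q ⊗ B
      ≈⟨ ⊖-cong (≈-trans KB≈A A≈) (≈-refl {reverse Q ⊗ B}) ⟩
    (reverse Q ⊗ B ⊕ reverse remainder) ⊖ reverse Q ⊗ B
      ≈⟨ solve 2 (λ p r → (p :+ r) :- p := r) ≈-refl (reverse Q ⊗ B) (reverse remainder) ⟩
    reverse remainder ∎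
  K≈Q : K ≈ reverse Q
  K≈Q = ⊖≈[]⇒≈ (⊗-zero-degree mB (K ⊖ reverse Q) λ k n≤k → trans (at R≈ k)
    (coeff-length≤ (reverse remainder) (ℕₚ.≤-trans (ℕₚ.≤-reflexive (Listₚ.length-reverse remainder))
      (ℕₚ.≤-trans small (ℕₚ.≤-trans (ℕₚ.≤-reflexive lB) n≤k)))))
  -- Otherwise K B = A has degree below that of B, hence K = 0 and A = 0, against the leading
  -- coefficient 1 of A.
  n≤m : n ≤ m
  n≤m with n ≤? m
  ... | yes l = l
  ... | no ≰ with () ← trans (sym (Monic-coeff mA))
          (at (≈-trans (≈-sym KB≈A) (⊗-cong {q = B} (⊗-zero-degree mB K λ k n≤k → trans (at KB≈A k)
             (coeff-length≤ A (ℕₚ.≤-trans (ℕₚ.≤-reflexive (Monic-length mA)) (ℕₚ.≤-trans (ℕₚ.≰⇒> ≰) n≤k)))) ≈-refl)) m)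
  tail = divide m (subtract as (scale (+ 1) bs)) bs⁺
  Q≡ : Q ≡ + 1 ∷ tail
  Q≡ = trans (divide-step m (+ 1) as (+ 1) bs) (cong (λ t → if t then [] else + 1 ∷ tail)
    (<ᵇ-false (s≤s (subst (_≤ length as) (sym lB) (subst (n ≤_) (sym lA) n≤m)))))
  monic : IsMonic (quotMonic A B)
  monic = _ , subst (Monic _) (sym (trans quot≡ (trans (cong reverse Q≡) (Listₚ.unfold-reverse (+ 1) tail))))
                (Monic-∷ʳ (reverse tail))

-- If xm = d + yn, then X^(xm) - 1 = X^d (X^(yn) - 1) + (X^d - 1), and X^(xm) - 1 and X^(yn) - 1 are
-- multiples of X^m - 1 and X^n - 1.
Δ-bézout : ∀ {d m n} → Bézout.Identity d m n → ∃ λ U → ∃ λ V → U ⊗ Δ m ⊕ V ⊗ Δ n ≈ Δ d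
Δ-bézout {d} {m} {n} (Bézout.+- x y eq) = geo m x , ⊝ (X^ d ⊗ geo n y) , (begin
  geo m x ⊗ Δ m ⊕ ⊝ (X^ d ⊗ geo n y) ⊗ Δ n
    ≈⟨ solve 5 (λ g a x h b → g :* a :+ :- (x :* h) :* b := a :* g :- x :* (b :* h)) ≈-refl (geo m x) (Δ m) (X^ d) (geo n y) (Δ n) ⟩
  Δ m ⊗ geo m x ⊖ X^ d ⊗ (Δ n ⊗ geo n y)
    ≈⟨ ⊖-cong (Δ-* m x) (⊗-congʳ (X^ d) (Δ-* n y)) ⟨
  Δ (x * m) ⊖ X^ d ⊗ Δ (y * n)
    ≡⟨ cong (λ k → Δ k ⊖ X^ d ⊗ Δ (y * n)) eq ⟨
  Δ (d + y * n) ⊖ X^ d ⊗ Δ (y * n)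
    ≈⟨ ⊖-cong (Δ-+ d (y * n)) (≈-refl {X^ d ⊗ Δ (y * n)}) ⟩
  (X^ d ⊗ Δ (y * n) ⊕ Δ d) ⊖ X^ d ⊗ Δ (y * n)
    ≈⟨ solve 2 (λ p q → (p :+ q) :- p := q) ≈-refl (X^ d ⊗ Δ (y * n)) (Δ d) ⟩
  Δ d ∎)
Δ-bézout {d} {m} {n} (Bézout.-+ x y eq) =
  let U , V , e = Δ-bézout {d} {n} {m} (Bézout.+- y x eq) in V , U , ≈-trans (⊕-comm (V ⊗ Δ m) (U ⊗ Δ n)) e

-- Divisibility and a Bézout identity for the polynomials Φ₃(X^m).

NotMultipleOf3 : ℕ → Set
NotMultipleOf3 k = (∃ λ a → k ≡ 1 + a * 3) ⊎ (∃ λ a → k ≡ 2 + a * 3)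

X^-3* : ∀ m → X^ (3 * m) ≈ X^ m ⊗ X^ m ⊗ X^ m
X^-3* m = begin
  X^ (m + (m + (m + 0)))           ≈⟨ ≈-trans (X^-+ m _) (⊗-congʳ (X^ m) (≈-trans (X^-+ m _) (⊗-congʳ (X^ m) (X^-+ m 0)))) ⟩
  X^ m ⊗ (X^ m ⊗ (X^ m ⊗ one))     ≈⟨ solve 1 (λ x → x :* (x :* (x :* con (+ 1))) := x :* x :* x) ≈-refl (X^ m) ⟩
  X^ m ⊗ X^ m ⊗ X^ m               ∎

X^-mod : ∀ j a m → X^ ((j + a * 3) * m) ≈ X^ (j * m) ⊗ (one ⊕ (X^ m ⊗ X^ m ⊗ X^ m ⊖ one) ⊗ geo (3 * m) a)
X^-mod j a m = begin
  X^ ((j + a * 3) * m)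
    ≡⟨ cong X^ (trans (ℕₚ.*-distribʳ-+ m j (a * 3)) (cong (_+_ (j * m)) (ℕₚ.*-assoc a 3 m))) ⟩
  X^ (j * m + a * (3 * m))
    ≈⟨ X^-+ (j * m) _ ⟩
  X^ (j * m) ⊗ X^ (a * (3 * m))
    ≈⟨ ⊗-congʳ (X^ (j * m)) (solve 1 (λ x → x := con (+ 1) :+ (x :- con (+ 1))) ≈-refl (X^ (a * (3 * m)))) ⟩
  X^ (j * m) ⊗ (one ⊕ Δ (a * (3 * m)))
    ≈⟨ ⊗-congʳ (X^ (j * m)) (⊕-cong (≈-refl {one}) (≈-trans (Δ-* (3 * m) a) (⊗-cong (⊖-cong (X^-3* m) (≈-refl {one})) ≈-refl))) ⟩
  X^ (j * m) ⊗ (one ⊕ (X^ m ⊗ X^ m ⊗ X^ m ⊖ one) ⊗ geo (3 * m) a) ∎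

1+X+X² : Poly → Poly
1+X+X² p = one ⊕ p ⊕ p ⊗ p

geo-3 : ∀ m → geo m 3 ≈ 1+X+X² (X^ m)
geo-3 m = begin
  one ⊕ x ⊗ (one ⊕ x ⊗ (one ⊕ x ⊗ []))
    ≈⟨ ⊕-cong (≈-refl {one}) (⊗-congʳ x (⊕-cong (≈-refl {one}) (⊗-congʳ x (⊕-cong (≈-refl {one}) (⊗-zeroʳ x))))) ⟩
  one ⊕ x ⊗ (one ⊕ x ⊗ one)
    ≈⟨ solve 1 (λ x → con (+ 1) :+ x :* (con (+ 1) :+ x :* con (+ 1)) := con (+ 1) :+ x :+ x :* x) ≈-refl x ⟩
  1+X+X² x ∎
  where x = X^ m

1+X+X²-cong : ∀ {p q} → p ≈ q → 1+X+X² p ≈ 1+X+X² q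
1+X+X²-cong e = ⊕-cong (⊕-cong (≈-refl {one}) e) (⊗-cong e e)

-- Modulo X^(3m) - 1 the exponents 0, km, 2km are 0, m, 2m in some order. To find S, put x = X^m, d
-- = x³ - 1, write X^(km) as x (1 + d g) or x² (1 + d g), and collect the multiples of d.
geo-mod-3 : ∀ {k} m → NotMultipleOf3 k → ∃ λ S → geo (k * m) 3 ≈ geo m 3 ⊕ (X^ m ⊗ X^ m ⊗ X^ m ⊖ one) ⊗ S
geo-mod-3 m (inj₁ (a , refl)) = x ⊗ g ⊕ x ⊗ x ⊗ (g ⊕ g ⊕ (x ⊗ x ⊗ x ⊖ one) ⊗ g ⊗ g) , (begin
  geo ((1 + a * 3) * m) 3
    ≈⟨ geo-3 ((1 + a * 3) * m) ⟩
  1+X+X² (X^ ((1 + a * 3) * m))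
    ≈⟨ 1+X+X²-cong (≈-trans (X^-mod 1 a m) (⊗-cong (≈-reflexive (cong X^ (ℕₚ.+-identityʳ m))) ≈-refl)) ⟩
  1+X+X² (x ⊗ (one ⊕ (x ⊗ x ⊗ x ⊖ one) ⊗ g))
    ≈⟨ solve 2 (λ x g → let d = x :* x :* x :- con (+ 1); y = x :* (con (+ 1) :+ d :* g) in
         con (+ 1) :+ y :+ y :* y :=
         (con (+ 1) :+ x :+ x :* x) :+ d :* (x :* g :+ x :* x :* (g :+ g :+ d :* g :* g))) ≈-refl x g ⟩
  1+X+X² x ⊕ (x ⊗ x ⊗ x ⊖ one) ⊗ (x ⊗ g ⊕ x ⊗ x ⊗ (g ⊕ g ⊕ (x ⊗ x ⊗ x ⊖ one) ⊗ g ⊗ g))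
    ≈⟨ ⊕-cong (geo-3 m) ≈-refl ⟨
  geo m 3 ⊕ (x ⊗ x ⊗ x ⊖ one) ⊗ (x ⊗ g ⊕ x ⊗ x ⊗ (g ⊕ g ⊕ (x ⊗ x ⊗ x ⊖ one) ⊗ g ⊗ g)) ∎)
  where
  x = X^ m
  g = geo (3 * m) a
-- Now the square of X^(km) starts with x⁴ = x + d x, which accounts for the extra summand x.
geo-mod-3 m (inj₂ (a , refl)) = x ⊗ x ⊗ g ⊕ x ⊕ x ⊗ x ⊗ x ⊗ x ⊗ (g ⊕ g ⊕ (x ⊗ x ⊗ x ⊖ one) ⊗ g ⊗ g) , (begin
  geo ((2 + a * 3) * m) 3
    ≈⟨ geo-3 ((2 + a * 3) * m) ⟩
  1+X+X² (X^ ((2 + a * 3) * m))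
    ≈⟨ 1+X+X²-cong (≈-trans (X^-mod 2 a m) (⊗-cong (≈-trans (≈-reflexive (cong (λ k → X^ (m + k)) (ℕₚ.+-identityʳ m))) (X^-+ m m)) ≈-refl)) ⟩
  1+X+X² (x ⊗ x ⊗ (one ⊕ (x ⊗ x ⊗ x ⊖ one) ⊗ g))
    ≈⟨ solve 2 (λ x g → let d = x :* x :* x :- con (+ 1); y = x :* x :* (con (+ 1) :+ d :* g) in
         con (+ 1) :+ y :+ y :* y :=
         (con (+ 1) :+ x :+ x :* x) :+ d :* (x :* x :* g :+ x :+ x :* x :* x :* x :* (g :+ g :+ d :* g :* g))) ≈-refl x g ⟩
  1+X+X² x ⊕ (x ⊗ x ⊗ x ⊖ one) ⊗ (x ⊗ x ⊗ g ⊕ x ⊕ x ⊗ x ⊗ x ⊗ x ⊗ (g ⊕ g ⊕ (x ⊗ x ⊗ x ⊖ one) ⊗ g ⊗ g))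
    ≈⟨ ⊕-cong (geo-3 m) ≈-refl ⟨
  geo m 3 ⊕ (x ⊗ x ⊗ x ⊖ one) ⊗ (x ⊗ x ⊗ g ⊕ x ⊕ x ⊗ x ⊗ x ⊗ x ⊗ (g ⊕ g ⊕ (x ⊗ x ⊗ x ⊖ one) ⊗ g ⊗ g)) ∎)
  where
  x = X^ m
  g = geo (3 * m) a

-- With x = X^m, the correction in `geo-mod-3` is a multiple of x³ - 1 and hence of 1 + x + x². This
-- serves to show that Φ₃(X^q) and Φ₃(X^r) both divide Φ₃(X^qr).
geo-∣ : ∀ {k} m → NotMultipleOf3 k → geo m 3 ∣ₚ geo (k * m) 3
geo-∣ {k} m h with geo-mod-3 m h
... | S , e = one ⊕ (x ⊖ one) ⊗ S , (begin
  geo (k * m) 3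
    ≈⟨ e ⟩
  geo m 3 ⊕ (x ⊗ x ⊗ x ⊖ one) ⊗ S
    ≈⟨ ⊕-cong (geo-3 m) ≈-refl ⟩
  1+X+X² x ⊕ (x ⊗ x ⊗ x ⊖ one) ⊗ S
    ≈⟨ solve 2 (λ x s → (con (+ 1) :+ x :+ x :* x) :+ (x :* x :* x :- con (+ 1)) :* s
        := (con (+ 1) :+ x :+ x :* x) :* (con (+ 1) :+ (x :- con (+ 1)) :* s)) ≈-refl x S ⟩
  1+X+X² x ⊗ (one ⊕ (x ⊖ one) ⊗ S)
    ≈⟨ ⊗-cong (geo-3 m) ≈-refl ⟨
  geo m 3 ⊗ (one ⊕ (x ⊖ one) ⊗ S) ∎)
  where x = X^ m

Bézout-scale : ∀ k {d m n} → Bézout.Identity d m n → Bézout.Identity (k * d) (k * m) (k * n)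
Bézout-scale k {d} {m} {n} (Bézout.+- x y eq) = Bézout.+- x y
  (trans (cong (_+_ (k * d)) (swap y n)) (trans (sym (ℕₚ.*-distribˡ-+ k d (y * n)))
    (trans (cong (_*_ k) eq) (sym (swap x m)))))
  where
  swap : ∀ a b → a * (k * b) ≡ k * (a * b)
  swap a b = trans (sym (ℕₚ.*-assoc a k b)) (trans (cong (_* b) (ℕₚ.*-comm a k)) (ℕₚ.*-assoc k a b))
Bézout-scale k (Bézout.-+ x y eq) = Bézout.Identity.sym (Bézout-scale k (Bézout.+- y x eq))

-- X³ - 1 lies in the ideal by the Bézout identity for 3q and 3r, and modulo
-- X³ - 1 the polynomial 1 + X^q + X^2q is 1 + X + X².
geo-bézout : ∀ {q r} → Coprime q r → NotMultipleOf3 q → ∃ λ U → ∃ λ V → U ⊗ geo q 3 ⊕ V ⊗ geo r 3 ≈ geo 1 3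
geo-bézout {q} {r} c h with Δ-bézout (Bézout-scale 3 (coprime-Bézout c)) | geo-mod-3 1 h
... | U , V , e | S , e′ = one ⊖ S ⊗ U ⊗ Δ q , ⊝ (S ⊗ V ⊗ Δ r) , (begin
  (one ⊖ S ⊗ U ⊗ Δ q) ⊗ geo q 3 ⊕ ⊝ (S ⊗ V ⊗ Δ r) ⊗ geo r 3
    ≈⟨ solve 7 (λ s u v a b x y → (con (+ 1) :- s :* u :* a) :* x :+ :- (s :* v :* b) :* y
         := x :- (u :* (a :* x) :+ v :* (b :* y)) :* s) ≈-refl S U V (Δ q) (Δ r) (geo q 3) (geo r 3) ⟩
  geo q 3 ⊖ (U ⊗ (Δ q ⊗ geo q 3) ⊕ V ⊗ (Δ r ⊗ geo r 3)) ⊗ S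
    ≈⟨ ⊖-cong (≈-refl {geo q 3}) (⊗-cong (⊕-cong (⊗-congʳ U (≈-sym (Δ-* q 3))) (⊗-congʳ V (≈-sym (Δ-* r 3)))) ≈-refl) ⟩
  geo q 3 ⊖ (U ⊗ Δ (3 * q) ⊕ V ⊗ Δ (3 * r)) ⊗ S
    ≈⟨ ⊖-cong (≈-trans (≈-reflexive (cong (λ k → geo k 3) (sym (ℕₚ.*-identityʳ q)))) e′) (⊗-cong e ≈-refl) ⟩
  (geo 1 3 ⊕ (X^ 1 ⊗ X^ 1 ⊗ X^ 1 ⊖ one) ⊗ S) ⊖ Δ 3 ⊗ S
    ≈⟨ ⊖-cong (⊕-cong (≈-refl {geo 1 3}) (⊗-cong (⊖-cong (X^-3* 1) (≈-refl {one})) (≈-refl {S}))) (≈-refl {Δ 3 ⊗ S}) ⟨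
  (geo 1 3 ⊕ Δ 3 ⊗ S) ⊖ Δ 3 ⊗ S
    ≈⟨ solve 2 (λ p q → (p :+ q) :- q := p) ≈-refl (geo 1 3) (Δ 3 ⊗ S) ⟩
  geo 1 3 ∎)

-- Divisor lists and the recursion for cyclotomic polynomials.

record IsDivisorList (n : ℕ) (L : List ℕ) : Set where
  field
    unique   : Unique L
    sound    : ∀ {d} → d ∈ L → d ∣ n
    complete : ∀ {d} → d ∣ n → d ∈ L

divisors-1 : IsDivisorList 1 (1 ∷ [])
divisors-1 = record
  { unique   = All.[] ∷ []
  ; sound    = λ { (here refl) → Div.∣-refl }
  ; complete = λ d∣1 → here (Div.∣1⇒≡1 d∣1) }

prime∤⇒coprime : ∀ {p d} → Prime p → ¬ p ∣ d → Coprime d p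
prime∤⇒coprime pp p∤d (i∣d , i∣p) with prime⇒irreducible pp i∣p
... | inj₁ i≡1  = i≡1
... | inj₂ refl = ⊥-elim (p∤d i∣d)

-- A divisor of pm either is coprime to p, and then divides m, or is p times a divisor of m. The two
-- kinds are disjoint since p does not divide m.
divisors-* : ∀ {p m L} → Prime p → ¬ p ∣ m → IsDivisorList m L → IsDivisorList (p * m) (map (p *_) L ++ L)
divisors-* {p} {m} {L} pp p∤m DL = record
  { unique   = Uniqueₚ.++⁺ (Uniqueₚ.map⁺ (λ {x} {y} → ℕₚ.*-cancelˡ-≡ x y p) DL.unique) DL.unique disjoint
  ; sound    = sound′
  ; complete = complete′ }
  where
  module DL = IsDivisorList DL
  instance _ = prime⇒nonZero pp
  disjoint : ∀ {d} → ¬ (d ∈ map (p *_) L × d ∈ L)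
  disjoint (d∈pL , d∈L) with ∈-map⁻ (p *_) d∈pL
  ... | e , _ , refl = p∤m (Div.∣-trans (Div.m∣m*n e) (DL.sound d∈L))
  sound′ : ∀ {d} → d ∈ map (p *_) L ++ L → d ∣ p * m
  sound′ d∈ with ∈-++⁻ (map (p *_) L) d∈
  ... | inj₂ d∈L = Div.∣n⇒∣m*n p (DL.sound d∈L)
  ... | inj₁ d∈pL with ∈-map⁻ (p *_) d∈pL
  ...   | e , e∈L , refl = Div.*-monoʳ-∣ p (DL.sound e∈L)
  complete′ : ∀ {d} → d ∣ p * m → d ∈ map (p *_) L ++ L
  complete′ {d} d∣ with p ∣? d
  ... | no p∤d = ∈-++⁺ʳ (map (p *_) L) (DL.complete (coprime-divisor (prime∤⇒coprime pp p∤d) d∣))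
  ... | yes (divides e refl) = ∈-++⁺ˡ (subst (_∈ map (p *_) L) (ℕₚ.*-comm p e)
      (∈-map⁺ (p *_) (DL.complete (Div.*-cancelˡ-∣ p (subst (_∣ p * m) (ℕₚ.*-comm e p) d∣)))))

-- Both lists are free of repetitions and have the same members. The product over the filtered range
-- can thus be replaced by one over a list built from the prime factors.
properDivisors-↭ : ∀ {n L} → IsDivisorList n (n ∷ L) → 1 ≤ n → properDivisors n ↭ L
properDivisors-↭ {n} {L} DL 1≤n with IsDivisorList.unique DL
... | n∉L ∷ uL = ∼bag⇒↭ (unique∧set⇒bag
    (Uniqueₚ.filter⁺ (_∣? n) (Uniqueₚ.map⁺ ℕₚ.suc-injective (Uniqueₚ.upTo⁺ (n ∸ 1)))) uL
    (mk⇔ to from))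
  where
  module DL = IsDivisorList DL
  instance _ = >-nonZero 1≤n
  to : ∀ {d} → d ∈ properDivisors n → d ∈ L
  to d∈ with ∈-filter⁻ (_∣? n) {xs = map suc (upTo (n ∸ 1))} d∈
  ... | d∈range , d∣n with ∈-map⁻ suc d∈range
  ...   | i , i∈ , refl with DL.complete d∣n
  ...     | there d∈L = d∈L
  ...     | here refl = ⊥-elim (ℕₚ.<-irrefl refl (∈-upTo⁻ i∈))
  from : ∀ {d} → d ∈ L → d ∈ properDivisors n
  from {zero} d∈L = ⊥-elim (ℕₚ.<⇒≢ 1≤n (sym (Div.0∣⇒≡0 (DL.sound (there d∈L)))))
  from {suc i} d∈L = ∈-filter⁺ (_∣? n) (∈-map⁺ suc (∈-upTo⁺ (ℕₚ.∸-monoˡ-≤ 1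
    (ℕₚ.≤∧≢⇒< (Div.∣⇒≤ d∣n) λ e → All.lookup n∉L d∈L (sym e))))) d∣n
    where d∣n = DL.sound (there d∈L)

prodP-↭ : ∀ {A : Set} (f : A → Poly) {xs ys} → xs ↭ ys → prodP (map f xs) ≈ prodP (map f ys)
prodP-↭ f Perm.refl = ≈-refl
prodP-↭ f (Perm.prep x e) = ⊗-congʳ (f x) (prodP-↭ f e)
prodP-↭ f {_ ∷ _ ∷ xs} {_ ∷ _ ∷ ys} (Perm.swap x y e) = begin
  f x ⊗ (f y ⊗ prodP (map f xs))
    ≈⟨ ⊗-congʳ (f x) (⊗-congʳ (f y) (prodP-↭ f e)) ⟩
  f x ⊗ (f y ⊗ prodP (map f ys))
    ≈⟨ solve 3 (λ x y p → x :* (y :* p) := y :* (x :* p)) ≈-refl (f x) (f y) (prodP (map f ys)) ⟩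
  f y ⊗ (f x ⊗ prodP (map f ys)) ∎
prodP-↭ f (Perm.trans e e′) = ≈-trans (prodP-↭ f e) (prodP-↭ f e′)

IsMonic-prodP : ∀ {A : Set} (f : A → Poly) xs → (∀ {x} → x ∈ xs → IsMonic (f x)) → IsMonic (prodP (map f xs))
IsMonic-prodP f []       h = 0 , lead
IsMonic-prodP f (x ∷ xs) h = _ , Monic-⊗ (proj₂ (h (here refl))) (proj₂ (IsMonic-prodP f xs λ x∈ → h (there x∈)))

IsMonic-xPowMinusOne : ∀ {n} → 1 ≤ n → IsMonic (xPowMinusOne n)
IsMonic-xPowMinusOne (s≤s {n = n} _) = _ , Monic-∷ʳ (-[1+ 0 ] ∷ replicate n (+ 0))

-- The next division needs the computed list to be monic as a list, while its value matters only up
-- to `≈`.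
_HasValue_ : Poly → Poly → Set
p HasValue q = IsMonic p × (p ≈ q)

cycFuel-value : ∀ {n L} f K → IsDivisorList n (n ∷ L) → 1 ≤ n →
  (∀ {d} → d ∈ L → IsMonic (cycFuel f d)) → K ⊗ prodP (map (cycFuel f) L) ≈ Δ n → cycFuel (suc f) n HasValue K
cycFuel-value {n} {L} f K DL 1≤n monic K⊗ =
  quotMonic-exact K (IsMonic-xPowMinusOne 1≤n)
    (IsMonic-prodP (cycFuel f) (properDivisors n) λ d∈ → monic (Permₚ.∈-resp-↭ perm d∈))
    (≈-trans (⊗-congʳ K (prodP-↭ (cycFuel f) perm)) (≈-trans K⊗ (≈-sym (xPowMinusOne-Δ n))))
  where
  perm = properDivisors-↭ DL 1≤n

-- One unit of fuel suffices for the index 1, and each prime factor adds one, since proper divisors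
-- have fewer prime factors.
cycFuel-1 : ∀ f → cycFuel (1 + f) 1 HasValue Δ 1
cycFuel-1 f = cycFuel-value f (Δ 1) divisors-1 (s≤s z≤n) (λ ()) (⊗-identityʳ (Δ 1))

∈[1]-monic : ∀ f {d} → d ∈ 1 ∷ [] → IsMonic (cycFuel (1 + f) d)
∈[1]-monic f (here refl) = proj₁ (cycFuel-1 f)

prime∤1 : ∀ {p} → Prime p → ¬ p ∣ 1
prime∤1 pp p∣1 with Div.∣1⇒≡1 p∣1
... | refl = ¬prime[1] pp

prime≥1 : ∀ {p} → Prime p → 1 ≤ p
prime≥1 pp = >-nonZero⁻¹ _ ⦃ prime⇒nonZero pp ⦄

divisors-prime : ∀ {p} → Prime p → IsDivisorList p (p ∷ 1 ∷ [])
divisors-prime {p} pp = subst (λ k → IsDivisorList k (k ∷ 1 ∷ [])) (ℕₚ.*-identityʳ p) (divisors-* pp (prime∤1 pp) divisors-1)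

Δ-prime : ∀ p → geo 1 p ⊗ Δ 1 ≈ Δ p
Δ-prime p = ≈-trans (⊗-comm (geo 1 p) (Δ 1)) (≈-trans (≈-sym (Δ-* 1 p)) (≈-reflexive (cong Δ (ℕₚ.*-identityʳ p))))

cycFuel-prime : ∀ {p} → Prime p → ∀ f → cycFuel (2 + f) p HasValue geo 1 p
cycFuel-prime {p} pp f = cycFuel-value (1 + f) (geo 1 p) (divisors-prime pp) (prime≥1 pp) (∈[1]-monic f)
  (product (cycFuel (1 + f)) (proj₂ (cycFuel-1 f)))
  where
  product : ∀ g → g 1 ≈ Δ 1 → geo 1 p ⊗ prodP (map g (1 ∷ [])) ≈ Δ p
  product g e = ≈-trans (⊗-congʳ (geo 1 p) (≈-trans (⊗-identityʳ (g 1)) e)) (Δ-prime p)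

prime≢⇒∤ : ∀ {p q} → Prime p → Prime q → ¬ p ≡ q → ¬ p ∣ q
prime≢⇒∤ pp pq p≢q p∣q with prime⇒irreducible pq p∣q
... | inj₁ refl = ¬prime[1] pp
... | inj₂ p≡q  = p≢q p≡q

divisors-prime² : ∀ {p q} → Prime p → Prime q → ¬ p ≡ q → IsDivisorList (p * q) (p * q ∷ p ∷ q ∷ 1 ∷ [])
divisors-prime² {p} {q} pp pq p≢q = subst (λ k → IsDivisorList (p * q) (p * q ∷ k ∷ q ∷ 1 ∷ [])) (ℕₚ.*-identityʳ p)
  (divisors-* pp (prime≢⇒∤ pp pq p≢q) (divisors-prime pq))

Δ-cancellable : ∀ {n} → 1 ≤ n → Cancellable (Δ n)
Δ-cancellable {n} (s≤s _) = unit-cancellable (Δ n) refl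

-- X^p - 1 and X^q - 1 have the Bézout combination X - 1, so their least common multiple (X - 1) Φ_p
-- Φ_q divides X^(pq) - 1; the cofactor K is Φ_pq. One K serves every amount of fuel.
cycFuel-prime² : ∀ {p q} → Prime p → Prime q → ¬ p ≡ q → ∃ λ K →
  (∀ f → cycFuel (3 + f) (p * q) HasValue K) × (Δ (p * q) ≈ Δ 1 ⊗ geo 1 p ⊗ geo 1 q ⊗ K)
cycFuel-prime² {p} {q} pp pq p≢q = K , value , e
  where
  bezout = Δ-bézout (coprime-Bézout (prime∤⇒coprime pq (prime≢⇒∤ pq pp λ e → p≢q (sym e))))
  divisible : Δ 1 ⊗ geo 1 p ⊗ geo 1 q ∣ₚ Δ (p * q)
  divisible = lcm-∣ {D = Δ 1} {U = proj₁ bezout} {V = proj₁ (proj₂ bezout)} (Δ-cancellable {1} (s≤s z≤n))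
    (≈-trans (≈-sym (Δ-prime p)) (⊗-comm (geo 1 p) (Δ 1))) (≈-trans (≈-sym (Δ-prime q)) (⊗-comm (geo 1 q) (Δ 1)))
    (proj₂ (proj₂ bezout)) (geo p q , ≈-trans (≈-reflexive (cong Δ (ℕₚ.*-comm p q))) (Δ-* p q)) (geo q p , Δ-* q p)
  K = proj₁ divisible
  e : Δ (p * q) ≈ Δ 1 ⊗ geo 1 p ⊗ geo 1 q ⊗ K
  e = proj₂ divisible
  product : ∀ g → g p ≈ geo 1 p → g q ≈ geo 1 q → g 1 ≈ Δ 1 → K ⊗ prodP (map g (p ∷ q ∷ 1 ∷ [])) ≈ Δ (p * q)
  product g gp gq g1 = begin
    K ⊗ (g p ⊗ (g q ⊗ (g 1 ⊗ one)))
      ≈⟨ ⊗-congʳ K (⊗-cong gp (⊗-cong gq (⊗-cong g1 (≈-refl {one})))) ⟩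
    K ⊗ (geo 1 p ⊗ (geo 1 q ⊗ (Δ 1 ⊗ one)))
      ≈⟨ solve 4 (λ k p q d → k :* (p :* (q :* (d :* con (+ 1)))) := d :* p :* q :* k) ≈-refl K (geo 1 p) (geo 1 q) (Δ 1) ⟩
    Δ 1 ⊗ geo 1 p ⊗ geo 1 q ⊗ K
      ≈⟨ e ⟨
    Δ (p * q) ∎
  value : ∀ f → cycFuel (3 + f) (p * q) HasValue K
  value f = cycFuel-value (2 + f) K (divisors-prime² pp pq p≢q) (ℕₚ.*-mono-≤ (prime≥1 pp) (prime≥1 pq))
    (λ { (here refl) → proj₁ (cycFuel-prime pp f)
       ; (there (here refl)) → proj₁ (cycFuel-prime pq f)
       ; (there (there d∈)) → ∈[1]-monic (1 + f) d∈ })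
    (product (cycFuel (2 + f)) (proj₂ (cycFuel-prime pp f)) (proj₂ (cycFuel-prime pq f)) (proj₂ (cycFuel-1 (1 + f))))

prime[3] : Prime 3
prime[3] = from-yes (prime? 3)

≢3 : ∀ {k} → NotMultipleOf3 k → ¬ 3 ≡ k
≢3 (inj₁ (suc zero , ())) refl
≢3 (inj₂ (suc zero , ())) refl

-- With F = Φ₃ Φ₃q Φ₃r this is Ψ₃qr = (X^qr - 1) F, where Φ₃ F = (Φ₃ Φ₃q)(Φ₃ Φ₃r).
Ψ-factorisation : ∀ {q r} → Prime q → Prime r → ¬ q ≡ r → NotMultipleOf3 q → NotMultipleOf3 r →
  ∃ λ F → (Ψ (3 * (q * r)) ≈ Δ (q * r) ⊗ F) × (geo 1 3 ⊗ F ≈ geo q 3 ⊗ geo r 3)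
Ψ-factorisation {q} {r} pq pr q≢r hq hr = F , Ψ≈ , geo⊗F
  where
  spec-q = cycFuel-prime² prime[3] pq (≢3 hq)
  spec-r = cycFuel-prime² prime[3] pr (≢3 hr)
  spec-qr = cycFuel-prime² pq pr q≢r
  Kq = proj₁ spec-q
  Kr = proj₁ spec-r
  Kqr = proj₁ spec-qr
  vq = proj₁ (proj₂ spec-q)
  vr = proj₁ (proj₂ spec-r)
  vqr = proj₁ (proj₂ spec-qr)
  eq = proj₂ (proj₂ spec-q)
  er = proj₂ (proj₂ spec-r)
  eqr = proj₂ (proj₂ spec-qr)
  bezout = geo-bézout {q} {r} (prime∤⇒coprime pr (prime≢⇒∤ pr pq λ e → q≢r (sym e))) hq
  U = proj₁ bezout
  V = proj₁ (proj₂ bezout)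
  bez = proj₂ (proj₂ bezout)
  F = geo 1 3 ⊗ Kq ⊗ Kr
  n = 3 * (q * r)
  geo-split : ∀ {p K} → Prime p → Δ (3 * p) ≈ Δ 1 ⊗ geo 1 3 ⊗ geo 1 p ⊗ K → geo p 3 ≈ geo 1 3 ⊗ K
  geo-split {p} {K} pp e = ⊗-cancelˡ {Δ p} (Δ-cancellable (prime≥1 pp)) (begin
    Δ p ⊗ geo p 3
      ≈⟨ Δ-* p 3 ⟨
    Δ (3 * p)
      ≈⟨ e ⟩
    Δ 1 ⊗ geo 1 3 ⊗ geo 1 p ⊗ K
      ≈⟨ solve 4 (λ d g p k → d :* g :* p :* k := p :* d :* (g :* k)) ≈-refl (Δ 1) (geo 1 3) (geo 1 p) K ⟩
    geo 1 p ⊗ Δ 1 ⊗ (geo 1 3 ⊗ K)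
      ≈⟨ ⊗-cong (Δ-prime p) ≈-refl ⟩
    Δ p ⊗ (geo 1 3 ⊗ K) ∎)
  geo⊗F : geo 1 3 ⊗ F ≈ geo q 3 ⊗ geo r 3
  geo⊗F = begin
    geo 1 3 ⊗ (geo 1 3 ⊗ Kq ⊗ Kr)
      ≈⟨ solve 3 (λ g a b → g :* (g :* a :* b) := (g :* a) :* (g :* b)) ≈-refl (geo 1 3) Kq Kr ⟩
    (geo 1 3 ⊗ Kq) ⊗ (geo 1 3 ⊗ Kr)
      ≈⟨ ⊗-cong (geo-split pq eq) (geo-split pr er) ⟨
    geo q 3 ⊗ geo r 3 ∎
  -- F is the least common multiple of Φ₃(X^q) = Φ₃ Φ₃q and Φ₃(X^r) = Φ₃ Φ₃r, both of which divide
  -- Φ₃(X^qr). The cofactor is Φ₃qr.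
  F∣ : F ∣ₚ geo (q * r) 3
  F∣ = lcm-∣ {D = geo 1 3} {U = U} {V = V} (unit-cancellable (geo 1 3) refl) (geo-split pq eq) (geo-split pr er) bez
    (subst (λ k → geo q 3 ∣ₚ geo k 3) (ℕₚ.*-comm r q) (geo-∣ q hr)) (geo-∣ r hq)
  K = proj₁ F∣
  product : ∀ g → g (3 * q) ≈ Kq → g (3 * r) ≈ Kr → g 3 ≈ geo 1 3 → g (q * r) ≈ Kqr → g q ≈ geo 1 q → g r ≈ geo 1 r → g 1 ≈ Δ 1 →
    prodP (map g (3 * q ∷ 3 * r ∷ 3 ∷ q * r ∷ q ∷ r ∷ 1 ∷ [])) ≈ Δ (q * r) ⊗ F
  product g e₁ e₂ e₃ e₄ e₅ e₆ e₇ = begin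
    g (3 * q) ⊗ (g (3 * r) ⊗ (g 3 ⊗ (g (q * r) ⊗ (g q ⊗ (g r ⊗ (g 1 ⊗ one))))))
      ≈⟨ ⊗-cong e₁ (⊗-cong e₂ (⊗-cong e₃ (⊗-cong e₄ (⊗-cong e₅ (⊗-cong e₆ (⊗-cong e₇ (≈-refl {one}))))))) ⟩
    Kq ⊗ (Kr ⊗ (geo 1 3 ⊗ (Kqr ⊗ (geo 1 q ⊗ (geo 1 r ⊗ (Δ 1 ⊗ one))))))
      ≈⟨ solve 7 (λ a b g k p s d → a :* (b :* (g :* (k :* (p :* (s :* (d :* con (+ 1))))))) := d :* p :* s :* k :* (g :* a :* b))
           ≈-refl Kq Kr (geo 1 3) Kqr (geo 1 q) (geo 1 r) (Δ 1) ⟩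
    Δ 1 ⊗ geo 1 q ⊗ geo 1 r ⊗ Kqr ⊗ F
      ≈⟨ ⊗-cong eqr (≈-refl {F}) ⟨
    Δ (q * r) ⊗ F ∎
  1≤qr : 1 ≤ q * r
  1≤qr = ℕₚ.*-mono-≤ (prime≥1 pq) (prime≥1 pr)
  monic : ∀ f {d} → d ∈ 3 * q ∷ 3 * r ∷ 3 ∷ q * r ∷ q ∷ r ∷ 1 ∷ [] → IsMonic (cycFuel (3 + f) d)
  monic f (here refl) = proj₁ (vq f)
  monic f (there (here refl)) = proj₁ (vr f)
  monic f (there (there (here refl))) = proj₁ (cycFuel-prime prime[3] (1 + f))
  monic f (there (there (there (here refl)))) = proj₁ (vqr f)
  monic f (there (there (there (there (here refl))))) = proj₁ (cycFuel-prime pq (1 + f))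
  monic f (there (there (there (there (there (here refl)))))) = proj₁ (cycFuel-prime pr (1 + f))
  monic f (there (there (there (there (there (there d∈)))))) = ∈[1]-monic (2 + f) d∈
  Δn≈ : (Δ (q * r) ⊗ F) ⊗ K ≈ Δ n
  Δn≈ = begin
    (Δ (q * r) ⊗ F) ⊗ K      ≈⟨ ⊗-assoc (Δ (q * r)) F K ⟩
    Δ (q * r) ⊗ (F ⊗ K)      ≈⟨ ⊗-congʳ (Δ (q * r)) (proj₂ F∣) ⟨
    Δ (q * r) ⊗ geo (q * r) 3 ≈⟨ Δ-* (q * r) 3 ⟨
    Δ n ∎
  divs : IsDivisorList n (n ∷ 3 * q ∷ 3 * r ∷ 3 ∷ q * r ∷ q ∷ r ∷ 1 ∷ [])
  divs = divisors-* prime[3] 3∤qr (divisors-prime² pq pr q≢r)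
    where
    3∤qr : ¬ 3 ∣ q * r
    3∤qr d = prime≢⇒∤ prime[3] pr (≢3 hr)
      (coprime-divisor (prime∤⇒coprime pq (prime≢⇒∤ pq prime[3] λ e → ≢3 hq (sym e))) d)
  value : ∀ f → cycFuel (4 + f) n HasValue K
  value f = cycFuel-value (3 + f) K divs (ℕₚ.*-mono-≤ {1} {3} (s≤s z≤n) 1≤qr) (monic f)
    (≈-trans (⊗-congʳ K (product (cycFuel (3 + f)) (proj₂ (vq f)) (proj₂ (vr f)) (proj₂ (cycFuel-prime prime[3] (1 + f)))
      (proj₂ (vqr f)) (proj₂ (cycFuel-prime pq (1 + f))) (proj₂ (cycFuel-prime pr (1 + f))) (proj₂ (cycFuel-1 (2 + f))))) (≈-trans (⊗-comm K (Δ (q * r) ⊗ F)) Δn≈))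
  Ψ≈ : Ψ n ≈ Δ (q * r) ⊗ F
  Ψ≈ = proj₂ (quotMonic-exact (Δ (q * r) ⊗ F) (IsMonic-xPowMinusOne (ℕₚ.≤-trans (s≤s z≤n) 4≤n)) (proj₁ Φn)
    (≈-trans (⊗-congʳ (Δ (q * r) ⊗ F) (proj₂ Φn)) (≈-trans Δn≈ (≈-sym (xPowMinusOne-Δ n)))))
    where
    -- `Φ n` runs with fuel n, and three prime factors take four units.
    4≤n : 4 ≤ n
    4≤n = ℕₚ.≤-trans {j = 6} (s≤s (s≤s (s≤s (s≤s z≤n)))) (ℕₚ.*-monoʳ-≤ 3
            (ℕₚ.*-mono-≤ {2} {q} {1} {r} (nonTrivial⇒n>1 q ⦃ prime⇒nonTrivial pq ⦄) (prime≥1 pr)))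
    Φn : Φ n HasValue K
    Φn = subst (λ f → cycFuel f n HasValue K) (ℕₚ.m+[n∸m]≡n 4≤n) (value (n ∸ 4))

-- The coefficients of F as sums of shifted power series.

-- Coefficients of the power series 1/(1 + X + X²).
u : ℕ → ℤ
u 0 = + 1
u 1 = -[1+ 0 ]
u 2 = + 0
u (suc (suc (suc k))) = u k

u-+3* : ∀ t j → u (j * 3 + t) ≡ u t
u-+3* t zero    = refl
u-+3* t (suc j) = u-+3* t j

shift : ℕ → (ℕ → ℤ) → ℕ → ℤ
shift zero    g k       = g k
shift (suc s) g zero    = + 0
shift (suc s) g (suc k) = shift s g k

shift-< : ∀ {s k} g → k < s → shift s g k ≡ + 0
shift-< {suc s} {zero}  g h       = refl
shift-< {suc s} {suc k} g (s≤s h) = shift-< {s} {k} g h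

shift-≥ : ∀ {s k} g → s ≤ k → shift s g k ≡ g (k ∸ s)
shift-≥ {zero}  g h = refl
shift-≥ {suc s} {suc k} g (s≤s h) = shift-≥ {s} {k} g h

coeff-X^⊗ : ∀ s p k → coeff (X^ s ⊗ p) k ≡ shift s (coeff p) k
coeff-X^⊗ zero    p k       = at (⊗-identityˡ p) k
coeff-X^⊗ (suc s) p zero    = at (0∷-⊗ (X^ s) p) 0
coeff-X^⊗ (suc s) p (suc k) = trans (at (0∷-⊗ (X^ s) p) (suc k)) (coeff-X^⊗ s p k)

times-1+X+X² : (ℕ → ℤ) → ℕ → ℤ
times-1+X+X² g 0             = g 0
times-1+X+X² g 1             = g 1 ℤ.+ g 0
times-1+X+X² g (suc (suc k)) = g (2 + k) ℤ.+ (g (1 + k) ℤ.+ g k)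

-- The constant term 1 lets each entry be recovered from the two before it. The comparison is made
-- among sequences because the summands X^s/(1 + X + X²) of F are not polynomials.
times-cancel : ∀ {g h} → (∀ k → times-1+X+X² g k ≡ times-1+X+X² h k) → ∀ k → g k ≡ h k
times-cancel {g} {h} e k = proj₁ (go k)
  where
  go : ∀ k → (g k ≡ h k) × (g (1 + k) ≡ h (1 + k))
  go zero    = e 0 , +-cancelʳ (g 0) _ _ (trans (e 1) (cong (ℤ._+_ (h 1)) (sym (e 0))))
  go (suc k) with go k
  ... | e₀ , e₁ = e₁ , +-cancelʳ (g (1 + k) ℤ.+ g k) _ _
    (trans (e (2 + k)) (cong (ℤ._+_ (h (2 + k))) (cong₂ ℤ._+_ (sym e₁) (sym e₀))))

coeff-geo-1-3 : ∀ p k → coeff (geo 1 3 ⊗ p) k ≡ times-1+X+X² (coeff p) k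
coeff-geo-1-3 p k = trans (at split k) (go k)
  where
  split : geo 1 3 ⊗ p ≈ p ⊕ (X^ 1 ⊗ p ⊕ X^ 2 ⊗ p)
  split = begin
    geo 1 3 ⊗ p                          ≈⟨ ⊗-cong (geo-3 1) ≈-refl ⟩
    1+X+X² (X^ 1) ⊗ p                    ≈⟨ solve 2 (λ x p → (con (+ 1) :+ x :+ x :* x) :* p := p :+ (x :* p :+ x :* x :* p)) ≈-refl (X^ 1) p ⟩
    p ⊕ (X^ 1 ⊗ p ⊕ X^ 1 ⊗ X^ 1 ⊗ p)     ≈⟨ ⊕-cong (≈-refl {p}) (⊕-cong (≈-refl {X^ 1 ⊗ p}) (⊗-cong (X^-+ 1 1) ≈-refl)) ⟨
    p ⊕ (X^ 1 ⊗ p ⊕ X^ 2 ⊗ p) ∎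
  expand : ∀ k → coeff (p ⊕ (X^ 1 ⊗ p ⊕ X^ 2 ⊗ p)) k ≡ coeff p k ℤ.+ (shift 1 (coeff p) k ℤ.+ shift 2 (coeff p) k)
  expand k = trans (coeff-⊕ p _ k) (cong (ℤ._+_ (coeff p k)) (trans (coeff-⊕ (X^ 1 ⊗ p) _ k)
    (cong₂ ℤ._+_ (coeff-X^⊗ 1 p k) (coeff-X^⊗ 2 p k))))
  go : ∀ k → coeff (p ⊕ (X^ 1 ⊗ p ⊕ X^ 2 ⊗ p)) k ≡ times-1+X+X² (coeff p) k
  go 0             = trans (expand 0) (ℤₚ.+-identityʳ _)
  go 1             = trans (expand 1) (cong (ℤ._+_ (coeff p 1)) (ℤₚ.+-identityʳ _))
  go (suc (suc k)) = expand (2 + k)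

times-u : ∀ s k → times-1+X+X² (shift s u) k ≡ coeff (X^ s) k
times-u zero 0 = refl
times-u zero 1 = refl
times-u zero 2 = refl
times-u zero (suc (suc (suc k))) = sum-u k
  where
  sum-u : ∀ k → u k ℤ.+ (u (2 + k) ℤ.+ u (1 + k)) ≡ + 0
  sum-u 0 = refl
  sum-u 1 = refl
  sum-u 2 = refl
  sum-u (suc (suc (suc k))) = sum-u k
times-u (suc s) 0 = refl
times-u (suc zero) 1 = refl
times-u (suc (suc s)) 1 = refl
times-u (suc s) (suc (suc zero)) = trans (cong (ℤ._+_ (shift s u 1)) (ℤₚ.+-identityʳ _)) (times-u s 1)
times-u (suc s) (suc (suc (suc k))) = times-u s (2 + k)

times-+ : ∀ g h k → times-1+X+X² (λ j → g j ℤ.+ h j) k ≡ times-1+X+X² g k ℤ.+ times-1+X+X² h k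
times-+ g h 0 = refl
times-+ g h 1 = +-medial (g 1) (h 1) (g 0) (h 0)
times-+ g h (suc (suc k)) = trans (cong (ℤ._+_ (g (2 + k) ℤ.+ h (2 + k))) (+-medial (g (1 + k)) (h (1 + k)) (g k) (h k)))
  (+-medial (g (2 + k)) (h (2 + k)) (g (1 + k) ℤ.+ g k) (h (1 + k) ℤ.+ h k))

-- A pair (a , b) stands for the monomial X^(a q + b r).
Exponents : Set
Exponents = List (ℕ × ℕ)

module _ (q r : ℕ) where

  exponent : ℕ × ℕ → ℕ
  exponent (a , b) = a * q + b * r

  monomials : Exponents → Poly
  monomials []       = []
  monomials (x ∷ xs) = X^ (exponent x) ⊕ monomials xs

  series : Exponents → ℕ → ℤ
  series []       k = + 0
  series (x ∷ xs) k = shift (exponent x) u k ℤ.+ series xs k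

  times-series : ∀ xs k → times-1+X+X² (series xs) k ≡ coeff (monomials xs) k
  times-series []       0 = refl
  times-series []       1 = refl
  times-series []       (suc (suc k)) = refl
  times-series (x ∷ xs) k = trans (times-+ (shift (exponent x) u) (series xs) k)
    (trans (cong₂ ℤ._+_ (times-u (exponent x) k) (times-series xs k)) (sym (coeff-⊕ (X^ (exponent x)) _ k)))

  coeff-series : ∀ {p} xs → geo 1 3 ⊗ p ≈ monomials xs → ∀ k → coeff p k ≡ series xs k
  coeff-series {p} xs e = times-cancel λ k →
    trans (sym (coeff-geo-1-3 p k)) (trans (at e k) (sym (times-series xs k)))

  -- By the period 3 of `u`, for s ≤ k the term u (k - s) equals u (k + 2 s). The latter avoids
  -- truncated subtraction and remains correct when k, q and r are replaced by residues, where s may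
  -- exceed k.
  value : Exponents → ℕ → ℤ
  value []             k = + 0
  value ((a , b) ∷ xs) k = u (k + 2 * (a * q + b * r)) ℤ.+ value xs k

  data Cut (k : ℕ) : ℕ → Exponents → Set where
    done  : Cut k 0 []
    above : ∀ {x xs} → k < exponent x → Cut k 0 xs → Cut k 0 (x ∷ xs)
    below : ∀ {m x xs} → exponent x ≤ k → Cut k m xs → Cut k (suc m) (x ∷ xs)

  data Increasing : Exponents → Set where
    single : ∀ {x} → Increasing (x ∷ [])
    _◂_    : ∀ {x y xs} → exponent x ≤ exponent y → Increasing (y ∷ xs) → Increasing (x ∷ y ∷ xs)
  infixr 5 _◂_

  cut-0 : ∀ {k x xs} → k < exponent x → Increasing (x ∷ xs) → Cut k 0 (x ∷ xs)
  cut-0 l single  = above l done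
  cut-0 l (h ◂ i) = above l (cut-0 (ℕₚ.<-≤-trans l h) i)

  cut : ∀ k {x xs} → Increasing (x ∷ xs) → ∃ λ m → Cut k m (x ∷ xs)
  cut k {x} inc with exponent x ≤? k
  ... | no ≰ = 0 , cut-0 (ℕₚ.≰⇒> ≰) inc
  cut k single  | yes ≤k = 1 , below ≤k done
  cut k (h ◂ i) | yes ≤k = _ , below ≤k (proj₂ (cut k i))

  Cut-≤ : ∀ {k m xs} → Cut k m xs → m ≤ length xs
  Cut-≤ done       = z≤n
  Cut-≤ (above _ _) = z≤n
  Cut-≤ (below _ c)   = s≤s (Cut-≤ c)

  series-cut : ∀ {k m xs} → Cut k m xs → series xs k ≡ value (take m xs) k
  series-cut done           = refl
  series-cut {k} (above {x} l c) = cong₂ ℤ._+_ (shift-< {exponent x} u l) (series-cut c)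
  series-cut {k} (below {m} {a , b} {xs} h c) = cong₂ ℤ._+_ (trans (shift-≥ {s} u h) (trans (sym (u-+3* (k ∸ s) s))
    (cong u (trans (regroup (k ∸ s) s) (cong (_+ 2 * s) (ℕₚ.m∸n+n≡m h)))))) (series-cut c)
    where
    s = a * q + b * r
    regroup : ∀ t s → s * 3 + t ≡ t + s + 2 * s
    regroup = ℕ-solve-∀

-- The increasing orders for q ≤ r ≤ 2q and for 2q ≤ r. They differ by exchanging r with 2q and 2r
-- with 2q + r.
orderA orderB : Exponents
orderA = (0 , 0) ∷ (1 , 0) ∷ (0 , 1) ∷ (2 , 0) ∷ (1 , 1) ∷ (0 , 2) ∷ (2 , 1) ∷ (1 , 2) ∷ (2 , 2) ∷ []
orderB = (0 , 0) ∷ (1 , 0) ∷ (2 , 0) ∷ (0 , 1) ∷ (1 , 1) ∷ (2 , 1) ∷ (0 , 2) ∷ (1 , 2) ∷ (2 , 2) ∷ []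

≤-by : ∀ {x y} z → x + z ≡ y → x ≤ y
≤-by {x} z e = ℕₚ.m+n≤o⇒m≤o x (ℕₚ.≤-reflexive e)

-- Here d = r - q and e = 2q - r. In these variables each gap between neighbouring exponents is d, e
-- or d + e, hence visibly nonnegative.
increasing-A : ∀ d e → Increasing (d + e) (d + (d + e)) orderA
increasing-A d e = z≤n ◂ ≤-by d (s₁ d e) ◂ ≤-by e (s₂ d e) ◂ ≤-by d (s₃ d e) ◂ ≤-by d (s₄ d e)
  ◂ ≤-by e (s₅ d e) ◂ ≤-by d (s₆ d e) ◂ ≤-by (d + e) (s₇ d e) ◂ single
  where
  s₁ : ∀ d e → 1 * (d + e) + 0 * (d + (d + e)) + d ≡ 0 * (d + e) + 1 * (d + (d + e))
  s₁ = ℕ-solve-∀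
  s₂ : ∀ d e → 0 * (d + e) + 1 * (d + (d + e)) + e ≡ 2 * (d + e) + 0 * (d + (d + e))
  s₂ = ℕ-solve-∀
  s₃ : ∀ d e → 2 * (d + e) + 0 * (d + (d + e)) + d ≡ 1 * (d + e) + 1 * (d + (d + e))
  s₃ = ℕ-solve-∀
  s₄ : ∀ d e → 1 * (d + e) + 1 * (d + (d + e)) + d ≡ 0 * (d + e) + 2 * (d + (d + e))
  s₄ = ℕ-solve-∀
  s₅ : ∀ d e → 0 * (d + e) + 2 * (d + (d + e)) + e ≡ 2 * (d + e) + 1 * (d + (d + e))
  s₅ = ℕ-solve-∀
  s₆ : ∀ d e → 2 * (d + e) + 1 * (d + (d + e)) + d ≡ 1 * (d + e) + 2 * (d + (d + e))
  s₆ = ℕ-solve-∀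
  s₇ : ∀ d e → 1 * (d + e) + 2 * (d + (d + e)) + (d + e) ≡ 2 * (d + e) + 2 * (d + (d + e))
  s₇ = ℕ-solve-∀

increasing-B : ∀ q e → Increasing q (2 * q + e) orderB
increasing-B q e = z≤n ◂ ≤-by q (s₁ q e) ◂ ≤-by e (s₂ q e) ◂ ≤-by q (s₃ q e) ◂ ≤-by q (s₄ q e)
  ◂ ≤-by e (s₅ q e) ◂ ≤-by q (s₆ q e) ◂ ≤-by q (s₇ q e) ◂ single
  where
  s₁ : ∀ q e → 1 * q + 0 * (2 * q + e) + q ≡ 2 * q + 0 * (2 * q + e)
  s₁ = ℕ-solve-∀
  s₂ : ∀ q e → 2 * q + 0 * (2 * q + e) + e ≡ 0 * q + 1 * (2 * q + e)
  s₂ = ℕ-solve-∀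
  s₃ : ∀ q e → 0 * q + 1 * (2 * q + e) + q ≡ 1 * q + 1 * (2 * q + e)
  s₃ = ℕ-solve-∀
  s₄ : ∀ q e → 1 * q + 1 * (2 * q + e) + q ≡ 2 * q + 1 * (2 * q + e)
  s₄ = ℕ-solve-∀
  s₅ : ∀ q e → 2 * q + 1 * (2 * q + e) + e ≡ 0 * q + 2 * (2 * q + e)
  s₅ = ℕ-solve-∀
  s₆ : ∀ q e → 0 * q + 2 * (2 * q + e) + q ≡ 1 * q + 2 * (2 * q + e)
  s₆ = ℕ-solve-∀
  s₇ : ∀ q e → 1 * q + 2 * (2 * q + e) + q ≡ 2 * q + 2 * (2 * q + e)
  s₇ = ℕ-solve-∀

power : Poly → ℕ → Poly
power p zero    = one
power p (suc a) = p ⊗ power p a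

-- With X^q and X^r as independent variables, the expansion into nine monomials becomes an identity
-- for the ring solver.
products : Poly → Poly → Exponents → Poly
products p p′ []             = []
products p p′ ((a , b) ∷ xs) = power p a ⊗ power p′ b ⊕ products p p′ xs

X^-* : ∀ a q → X^ (a * q) ≈ power (X^ q) a
X^-* zero    q = ≈-refl
X^-* (suc a) q = ≈-trans (X^-+ q (a * q)) (⊗-congʳ (X^ q) (X^-* a q))

monomials-products : ∀ q r xs → monomials q r xs ≈ products (X^ q) (X^ r) xs
monomials-products q r []             = ≈-refl
monomials-products q r ((a , b) ∷ xs) = ⊕-cong
  (≈-trans (X^-+ (a * q) (b * r)) (⊗-cong (X^-* a q) (X^-* b r))) (monomials-products q r xs)

-- The summand `[]` matches the end of `products`. The solver receives it as a third variable, since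
-- its own zero is `[ + 0 ]`.
expand : ∀ q r xs → 1+X+X² (X^ q) ⊗ 1+X+X² (X^ r) ⊕ [] ≈ products (X^ q) (X^ r) xs →
  geo q 3 ⊗ geo r 3 ≈ monomials q r xs
expand q r xs e = begin
  geo q 3 ⊗ geo r 3                          ≈⟨ ⊗-cong (geo-3 q) (geo-3 r) ⟩
  1+X+X² (X^ q) ⊗ 1+X+X² (X^ r)              ≈⟨ ⊕-identityʳ _ ⟨
  1+X+X² (X^ q) ⊗ 1+X+X² (X^ r) ⊕ []         ≈⟨ e ⟩
  products (X^ q) (X^ r) xs                  ≈⟨ monomials-products q r xs ⟨
  monomials q r xs                           ∎

expand-A : ∀ q r → geo q 3 ⊗ geo r 3 ≈ monomials q r orderA
expand-A q r = expand q r orderA (solve 3 (λ x y z →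
  let i = con (+ 1); x₁ = x :* i; x₂ = x :* x₁; y₁ = y :* i; y₂ = y :* y₁ in
  (i :+ x :+ x :* x) :* (i :+ y :+ y :* y) :+ z :=
  i :* i :+ (x₁ :* i :+ (i :* y₁ :+ (x₂ :* i :+ (x₁ :* y₁ :+ (i :* y₂ :+ (x₂ :* y₁ :+ (x₁ :* y₂ :+ (x₂ :* y₂ :+ z)))))))))
  ≈-refl (X^ q) (X^ r) [])

expand-B : ∀ q r → geo q 3 ⊗ geo r 3 ≈ monomials q r orderB
expand-B q r = expand q r orderB (solve 3 (λ x y z →
  let i = con (+ 1); x₁ = x :* i; x₂ = x :* x₁; y₁ = y :* i; y₂ = y :* y₁ in
  (i :+ x :+ x :* x) :* (i :+ y :+ y :* y) :+ z :=
  i :* i :+ (x₁ :* i :+ (x₂ :* i :+ (i :* y₁ :+ (x₁ :* y₁ :+ (x₂ :* y₁ :+ (i :* y₂ :+ (x₁ :* y₂ :+ (x₂ :* y₂ :+ z)))))))))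
  ≈-refl (X^ q) (X^ r) [])

-- Reduction modulo 3 and the finite tables.

value-mod : ∀ {q r k} ρ σ κ q′ r′ k′ → q ≡ ρ + q′ * 3 → r ≡ σ + r′ * 3 → k ≡ κ + k′ * 3 →
  ∀ xs → value q r xs k ≡ value ρ σ xs κ
value-mod ρ σ κ q′ r′ k′ refl refl refl []             = refl
value-mod ρ σ κ q′ r′ k′ refl refl refl ((a , b) ∷ xs) = cong₂ ℤ._+_
  (trans (cong u (regroup κ k′ a ρ q′ b σ r′)) (u-+3* (κ + 2 * (a * ρ + b * σ)) (k′ + 2 * (a * q′ + b * r′))))
  (value-mod ρ σ κ q′ r′ k′ refl refl refl xs)
  where
  regroup : ∀ κ k′ a ρ q′ b σ r′ → κ + k′ * 3 + 2 * (a * (ρ + q′ * 3) + b * (σ + r′ * 3))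
    ≡ (k′ + 2 * (a * q′ + b * r′)) * 3 + (κ + 2 * (a * ρ + b * σ))
  regroup = ℕ-solve-∀

-- The residues of q and r are 1 + ρ and 1 + σ, that of k is κ.
Exceptional : (m κ ρ σ : ℕ) → Set
Exceptional m κ ρ σ = (ρ ≡ σ) × ((m ≡ 3 × κ ≡ 2) ⊎ (m ≡ 6 × κ ≡ ρ))

-- Decided by evaluating 120 cases: ten values of m, three residues of k and two each for q and r.
table-A : ∀ {m} → m < 10 → ∀ {κ} → κ < 3 → ∀ {ρ} → ρ < 2 → ∀ {σ} → σ < 2 →
  let v = ℤ.∣ value (1 + ρ) (1 + σ) (take m orderA) κ ∣ in v ≤ 1 ⊎ (v ≤ 2 × Exceptional m κ ρ σ)
table-A = from-yes (allUpTo? (λ m → allUpTo? (λ κ → allUpTo? (λ ρ → allUpTo? (λ σ →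
  let v = ℤ.∣ value (1 + ρ) (1 + σ) (take m orderA) κ ∣ in
  (v ≤? 1) ⊎-dec ((v ≤? 2) ×-dec ((ρ ≟ σ) ×-dec (((m ≟ 3) ×-dec (κ ≟ 2)) ⊎-dec ((m ≟ 6) ×-dec (κ ≟ ρ)))))) 2) 2) 3) 10)

table-B : ∀ {m} → m < 10 → ∀ {κ} → κ < 3 → ∀ {ρ} → ρ < 2 → ∀ {σ} → σ < 2 →
  ℤ.∣ value (1 + ρ) (1 + σ) (take m orderB) κ ∣ ≤ 1
table-B = from-yes (allUpTo? (λ m → allUpTo? (λ κ → allUpTo? (λ ρ → allUpTo? (λ σ →
  ℤ.∣ value (1 + ρ) (1 + σ) (take m orderB) κ ∣ ≤? 1) 2) 2) 3) 10)

-- Beyond the last exponent all nine terms contribute, and they cancel. This bounds the degree of F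
-- from its coefficients alone.
vanishing-A : ∀ {κ} → κ < 3 → ∀ {ρ} → ρ < 2 → ∀ {σ} → σ < 2 → value (1 + ρ) (1 + σ) orderA κ ≡ + 0
vanishing-A = from-yes (allUpTo? (λ κ → allUpTo? (λ ρ → allUpTo? (λ σ →
  value (1 + ρ) (1 + σ) orderA κ ℤ.≟ + 0) 2) 2) 3)

vanishing-B : ∀ {κ} → κ < 3 → ∀ {ρ} → ρ < 2 → ∀ {σ} → σ < 2 → value (1 + ρ) (1 + σ) orderB κ ≡ + 0
vanishing-B = from-yes (allUpTo? (λ κ → allUpTo? (λ ρ → allUpTo? (λ σ →
  value (1 + ρ) (1 + σ) orderB κ ℤ.≟ + 0) 2) 2) 3)

-- An upper bound for the totient.

Unique-⊆-length : ∀ {xs ys : List ℕ} → Unique xs → Unique ys → (∀ {x} → x ∈ xs → x ∈ ys) → length xs ≤ length ys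
Unique-⊆-length {xs} {ys} ux uy xs⊆ys = ℕₚ.≤-trans (ℕₚ.≤-reflexive (Permₚ.↭-length (∼bag⇒↭ (unique∧set⇒bag ux
    (Uniqueₚ.filter⁺ (_∈? xs) uy)
    (mk⇔ (λ x∈ → ∈-filter⁺ (_∈? xs) (xs⊆ys x∈) x∈) (λ x∈ → proj₂ (∈-filter⁻ (_∈? xs) {xs = ys} x∈)))))))
  (Listₚ.length-filter (_∈? xs) ys)

∈-range : ∀ {n k} → 1 ≤ k → k ≤ n → k ∈ map suc (upTo n)
∈-range (s≤s _) k≤n = ∈-map⁺ suc (∈-upTo⁺ k≤n)

coprimes : ℕ → List ℕ
coprimes n = filter (λ k → gcd k n ≟ 1) (map suc (upTo n))

-- Sharing a divisor d > 1 with n keeps the members of `xs` apart from the numbers that `totient`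
-- counts, and both lists fit together into 1, ..., n.
totient-bound : ∀ {n} xs → Unique xs → (∀ {k} → k ∈ xs → 1 ≤ k × k ≤ n × ∃ λ d → 1 < d × d ∣ k × d ∣ n) →
  totient n + length xs ≤ n
totient-bound {n} xs ux h = ℕₚ.≤-trans (ℕₚ.≤-reflexive (sym (Listₚ.length-++ (coprimes n))))
  (ℕₚ.≤-trans (Unique-⊆-length (Uniqueₚ.++⁺ (Uniqueₚ.filter⁺ (λ k → gcd k n ≟ 1) range-unique) ux disjoint) range-unique into-range)
    (ℕₚ.≤-reflexive (trans (Listₚ.length-map suc (upTo n)) (Listₚ.length-upTo n))))
  where
  range-unique : Unique (map suc (upTo n))
  range-unique = Uniqueₚ.map⁺ ℕₚ.suc-injective (Uniqueₚ.upTo⁺ n)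
  disjoint : ∀ {k} → ¬ (k ∈ coprimes n × k ∈ xs)
  disjoint (k∈ , k∈xs) with h k∈xs
  ... | _ , _ , d , 1<d , d∣k , d∣n = ℕₚ.<⇒≢ 1<d (sym (Div.∣1⇒≡1 (subst (d ∣_)
    (proj₂ (∈-filter⁻ (λ k → gcd k n ≟ 1) {xs = map suc (upTo n)} k∈)) (gcd-greatest d∣k d∣n))))
  into-range : ∀ {k} → k ∈ coprimes n ++ xs → k ∈ map suc (upTo n)
  into-range k∈ with ∈-++⁻ (coprimes n) k∈
  ... | inj₁ k∈c = proj₁ (∈-filter⁻ (λ k → gcd k n ≟ 1) {xs = map suc (upTo n)} k∈c)
  ... | inj₂ k∈xs with h k∈xs
  ...   | 1≤k , k≤n , _ = ∈-range 1≤k k≤n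

3∤1+3* : ∀ i → ¬ 3 ∣ 1 + i * 3
3∤1+3* i d with s≤s () ← Div.∣⇒≤ (Div.∣m+n∣m⇒∣n (subst (3 ∣_) (ℕₚ.+-comm 1 (i * 3)) d) (divides i refl))

-- The multiples of 3, the numbers q (3i + 1) and the number 2q are not coprime to 3qr.
totient-3qr : ∀ {q r} → Prime q → ¬ 3 ≡ q → 1 ≤ r → totient (3 * (q * r)) + (q * r + (r + 1)) ≤ 3 * (q * r)
totient-3qr {q} {r} pq 3≢q 1≤r = ℕₚ.≤-trans (ℕₚ.≤-reflexive (cong (_+_ (totient (3 * (q * r)))) (sym length≡)))
  (totient-bound (threes ++ (qs ++ 2q)) unique bounds)
  where
  instance _ = prime⇒nonZero pq
  f g : ℕ → ℕ
  f i = 3 * suc i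
  g i = q * (1 + i * 3)
  threes = map f (upTo (q * r))
  qs = map g (upTo r)
  2q = (q * 2) ∷ []
  length≡ : length (threes ++ (qs ++ 2q)) ≡ q * r + (r + 1)
  length≡ = trans (Listₚ.length-++ threes) (cong₂ _+_ (trans (Listₚ.length-map f (upTo (q * r))) (Listₚ.length-upTo (q * r)))
    (trans (Listₚ.length-++ qs) (cong (_+ 1) (trans (Listₚ.length-map g (upTo r)) (Listₚ.length-upTo r)))))
  3∤q* : ∀ {k} → ¬ 3 ∣ k → ¬ 3 ∣ q * k
  3∤q* 3∤k d = 3∤k (coprime-divisor (prime∤⇒coprime pq (prime≢⇒∤ pq prime[3] λ e → 3≢q (sym e))) d)
  qs-2q-disjoint : ∀ {k} → ¬ (k ∈ qs × k ∈ 2q)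
  qs-2q-disjoint (k∈qs , here refl) with ∈-map⁻ g k∈qs
  ... | i , _ , e with i | ℕₚ.*-cancelˡ-≡ 2 (1 + i * 3) q e
  ...   | zero  | ()
  ...   | suc _ | ()
  disjoint : ∀ {k} → ¬ (k ∈ threes × k ∈ qs ++ 2q)
  disjoint (k∈ , k∈′) with ∈-map⁻ f k∈
  ... | j , _ , refl with ∈-++⁻ qs k∈′
  ...   | inj₂ (here e) = 3∤q* {2} (λ d → ℕₚ.<⇒≱ (s≤s (s≤s (s≤s z≤n))) (Div.∣⇒≤ d)) (subst (3 ∣_) e (Div.m∣m*n (suc j)))
  ...   | inj₁ k∈qs with ∈-map⁻ g k∈qs
  ...     | i , _ , e = 3∤q* (3∤1+3* i) (subst (3 ∣_) e (Div.m∣m*n (suc j)))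
  unique : Unique (threes ++ (qs ++ 2q))
  unique = Uniqueₚ.++⁺ (Uniqueₚ.map⁺ (λ e → ℕₚ.suc-injective (ℕₚ.*-cancelˡ-≡ _ _ 3 e)) (Uniqueₚ.upTo⁺ (q * r)))
    (Uniqueₚ.++⁺ (Uniqueₚ.map⁺ (λ {x} {y} e → ℕₚ.*-cancelʳ-≡ x y 3 (ℕₚ.suc-injective (ℕₚ.*-cancelˡ-≡ _ _ q e))) (Uniqueₚ.upTo⁺ r))
      (All.[] ∷ []) qs-2q-disjoint) disjoint
  q*3r : q * (r * 3) ≡ 3 * (q * r)
  q*3r = trans (sym (ℕₚ.*-assoc q r 3)) (ℕₚ.*-comm (q * r) 3)
  q-bounds : ∀ {k} → 1 ≤ k → k ≤ r * 3 → 1 ≤ q * k × q * k ≤ 3 * (q * r) × ∃ λ d → 1 < d × d ∣ q * k × d ∣ 3 * (q * r)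
  q-bounds {k} 1≤k k≤ = ℕₚ.*-mono-≤ (prime≥1 pq) 1≤k , ℕₚ.≤-trans (ℕₚ.*-monoʳ-≤ q k≤) (ℕₚ.≤-reflexive q*3r) ,
    q , nonTrivial⇒n>1 q ⦃ prime⇒nonTrivial pq ⦄ , Div.m∣m*n k , Div.∣n⇒∣m*n 3 (Div.m∣m*n r)
  bounds : ∀ {k} → k ∈ threes ++ (qs ++ 2q) → 1 ≤ k × k ≤ 3 * (q * r) × ∃ λ d → 1 < d × d ∣ k × d ∣ 3 * (q * r)
  bounds k∈ with ∈-++⁻ threes k∈
  ... | inj₁ k∈3 with ∈-map⁻ f k∈3
  ...   | i , i∈ , refl = s≤s z≤n , ℕₚ.*-monoʳ-≤ 3 (∈-upTo⁻ i∈) , 3 , s≤s (s≤s z≤n) , Div.m∣m*n (suc i) , Div.m∣m*n (q * r)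
  bounds k∈ | inj₂ k∈q with ∈-++⁻ qs k∈q
  ...   | inj₂ (here refl) = q-bounds (s≤s z≤n) (ℕₚ.≤-trans (s≤s (s≤s z≤n)) (ℕₚ.*-monoˡ-≤ 3 1≤r))
  ...   | inj₁ k∈qs with ∈-map⁻ g k∈qs
  ...     | i , i∈ , refl = q-bounds (s≤s z≤n) (ℕₚ.≤-trans (s≤s (ℕₚ.m≤n+m (i * 3) 2)) (ℕₚ.*-monoˡ-≤ 3 (∈-upTo⁻ i∈)))

-- Bounds on the coefficients of F.

coeff-Δ⊗ : ∀ d p k → coeff (Δ d ⊗ p) k ≡ shift d (coeff p) k ℤ.+ ℤ.- coeff p k
coeff-Δ⊗ d p k = trans (at expanded k) (trans (coeff-⊕ (X^ d ⊗ p) (⊝ p) k)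
  (cong₂ ℤ._+_ (coeff-X^⊗ d p k) (trans (coeff-scale -[1+ 0 ] p k) (ℤₚ.-1*i≡-i _))))
  where
  expanded : Δ d ⊗ p ≈ X^ d ⊗ p ⊖ p
  expanded = solve 2 (λ x p → (x :- con (+ 1)) :* p := x :* p :- p) ≈-refl (X^ d) p

increasing-≤ : ∀ {q r} → q ≤ r → r ≤ 2 * q → Increasing q r orderA
increasing-≤ {q} {r} q≤r r≤2q with ℕₚ.m≤n⇒∃[o]m+o≡n q≤r | ℕₚ.m≤n⇒∃[o]m+o≡n r≤2q
... | d , refl | e , eq = subst₂ (λ x y → Increasing x y orderA) d+e≡q (trans (cong (_+_ d) d+e≡q) (ℕₚ.+-comm d q)) (increasing-A d e)
  where
  d+e≡q : d + e ≡ q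
  d+e≡q = ℕₚ.+-cancelˡ-≡ q _ _ (trans (sym (ℕₚ.+-assoc q d e)) (trans eq (cong (_+_ q) (ℕₚ.+-identityʳ q))))

increasing-≥ : ∀ {q r} → 2 * q ≤ r → Increasing q r orderB
increasing-≥ {q} 2q≤r with ℕₚ.m≤n⇒∃[o]m+o≡n 2q≤r
... | e , refl = increasing-B q e

module Residues {q r ρ σ : ℕ} (q′ r′ : ℕ) (q≡ : q ≡ 1 + ρ + q′ * 3) (r≡ : r ≡ 1 + σ + r′ * 3) (ρ<2 : ρ < 2) (σ<2 : σ < 2) where

  series-value : ∀ {k m xs} → Cut q r k m xs → series q r xs k ≡ value (1 + ρ) (1 + σ) (take m xs) (k % 3)
  series-value {k} {m} {xs} c = trans (series-cut q r c)
    (value-mod (1 + ρ) (1 + σ) (k % 3) q′ r′ (k / 3) q≡ r≡ (m≡m%n+[m/n]*n k 3) (take m xs))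

  series-A-bound : Increasing q r orderA → ∀ k → ℤ.∣ series q r orderA k ∣ ≤ 1 ⊎
    (ℤ.∣ series q r orderA k ∣ ≤ 2 × ∃ λ m → Cut q r k m orderA × Exceptional m (k % 3) ρ σ)
  series-A-bound inc k = let m , c = cut q r k inc in
    Sum.map (subst (λ v → ℤ.∣ v ∣ ≤ 1) (sym (series-value c)))
      (λ (le , x) → subst (λ v → ℤ.∣ v ∣ ≤ 2) (sym (series-value c)) le , m , c , x)
      (table-A {m} (s≤s (Cut-≤ q r c)) {k % 3} (m%n<n k 3) {ρ} ρ<2 {σ} σ<2)

  series-B-bound : Increasing q r orderB → ∀ k → ℤ.∣ series q r orderB k ∣ ≤ 1
  series-B-bound inc k with cut q r k inc
  ... | m , c = subst (λ v → ℤ.∣ v ∣ ≤ 1) (sym (series-value c))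
    (table-B {m} (s≤s (Cut-≤ q r c)) {k % 3} (m%n<n k 3) {ρ} ρ<2 {σ} σ<2)

  last-≤ : ∀ {xs k} → Increasing q r xs → All.All (λ x → exponent q r x ≤ 2 * q + 2 * r) xs →
    2 * q + 2 * r ≤ k → Cut q r k (length xs) xs
  last-≤ single  (h All.∷ _)  l = below (ℕₚ.≤-trans h l) done
  last-≤ (_ ◂ i) (h All.∷ hs) l = below (ℕₚ.≤-trans h l) (last-≤ i hs l)

  exponent-≤ : ∀ {a b} → a ≤ 2 → b ≤ 2 → exponent q r (a , b) ≤ 2 * q + 2 * r
  exponent-≤ a≤ b≤ = ℕₚ.+-mono-≤ (ℕₚ.*-monoˡ-≤ q a≤) (ℕₚ.*-monoˡ-≤ r b≤)

  series-A-vanish : Increasing q r orderA → ∀ {k} → 2 * q + 2 * r ≤ k → series q r orderA k ≡ + 0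
  series-A-vanish inc {k} l = trans (series-value (last-≤ inc bounds l)) (vanishing-A (m%n<n k 3) {ρ} ρ<2 {σ} σ<2)
    where
    bounds : All.All (λ x → exponent q r x ≤ 2 * q + 2 * r) orderA
    bounds = All.map (λ { (a , b) → exponent-≤ a b }) (from-yes (All.all? (λ (a , b) → (a ≤? 2) ×-dec (b ≤? 2)) orderA))

  series-B-vanish : Increasing q r orderB → ∀ {k} → 2 * q + 2 * r ≤ k → series q r orderB k ≡ + 0
  series-B-vanish inc {k} l = trans (series-value (last-≤ inc bounds l)) (vanishing-B (m%n<n k 3) {ρ} ρ<2 {σ} σ<2)
    where
    bounds : All.All (λ x → exponent q r x ≤ 2 * q + 2 * r) orderB
    bounds = All.map (λ { (a , b) → exponent-≤ a b }) (from-yes (All.all? (λ (a , b) → (a ≤? 2) ×-dec (b ≤? 2)) orderB))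

-- Below q only the monomial 1 contributes. As q ≥ 5, F begins with the coefficients 1, -1, 0, which
-- supply the values -1, 1, 0 of V. The right side is left in the form to which `value` reduces.
series-initial : ∀ {q r k xs} → k < q → Increasing q r ((0 , 0) ∷ (1 , 0) ∷ xs) → series q r ((0 , 0) ∷ (1 , 0) ∷ xs) k ≡ u (k + 0) ℤ.+ + 0
series-initial {q} {r} {k} k<q (h ◂ inc) = series-cut q r (below {x = 0 , 0} z≤n (cut-0 q r (subst (k <_) (sym (trans (ℕₚ.+-identityʳ (q + 0)) (ℕₚ.+-identityʳ q))) k<q) inc))

-- The gap e = 2q - r and the exceptional cases.

gap-parity : ∀ {q r e} → r % 2 ≡ 1 → r + e ≡ 2 * q → (1 + e) % 2 ≡ 0
gap-parity {q} {r} {e} odd eq = trans (sym ([m+kn]%n≡m%n (1 + e) (r / 2) 2)) (trans (cong (_% 2) lem) (m*n%n≡0 q 2))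
  where
  rearrange : ∀ e h → 1 + e + h * 2 ≡ 1 + h * 2 + e
  rearrange = ℕ-solve-∀
  lem : 1 + e + r / 2 * 2 ≡ q * 2
  lem = trans (rearrange e (r / 2)) (trans (cong (_+ e) (trans (cong (_+ r / 2 * 2) (sym odd)) (sym (m≡m%n+[m/n]*n r 2))))
    (trans eq (ℕₚ.*-comm 2 q)))

gap-mod-3 : ∀ {q r e ρ q′ r′} → q ≡ 1 + ρ + q′ * 3 → r ≡ 1 + ρ + r′ * 3 → r + e ≡ 2 * q → (1 + ρ + e) % 3 ≡ (2 * (1 + ρ)) % 3
gap-mod-3 {e = e} {ρ} {q′} {r′} refl refl eq = trans (sym ([m+kn]%n≡m%n (1 + ρ + e) r′ 3))
  (trans (cong (_% 3) (trans (lem₁ ρ e r′) (trans eq (lem₂ ρ q′)))) ([m+kn]%n≡m%n (2 * (1 + ρ)) (2 * q′) 3))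
  where
  lem₁ : ∀ ρ e r′ → 1 + ρ + e + r′ * 3 ≡ 1 + ρ + r′ * 3 + e
  lem₁ = ℕ-solve-∀
  lem₂ : ∀ ρ q′ → 2 * (1 + ρ + q′ * 3) ≡ 2 * (1 + ρ) + 2 * q′ * 3
  lem₂ = ℕ-solve-∀

-- The congruences say e ≡ 1 (mod 6), so after 1 the next possible gap is 7: the origin of the
-- threshold 2q - 7.
small-gap-1 : ∀ {e} → e < 7 → (1 + e) % 2 ≡ 0 → (1 + e) % 3 ≡ 2 → e ≡ 1
small-gap-1 = from-yes (allUpTo? (λ e → ((1 + e) % 2 ≟ 0) →-dec (((1 + e) % 3 ≟ 2) →-dec (e ≟ 1))) 7)

-- The congruences say e ≡ 5 (mod 6). Thus for q ≡ r ≡ 2 (mod 3), r ≤ 2q forces r ≤ 2q - 3.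
small-gap-2 : ∀ {e} → e < 3 → (1 + e) % 2 ≡ 0 → ¬ (2 + e) % 3 ≡ 1
small-gap-2 {0} _ () _
small-gap-2 {1} _ _  ()
small-gap-2 {2} _ () _
small-gap-2 {suc (suc (suc _))} (s≤s (s≤s (s≤s ()))) _ _

-- Write r + e = 2q. By the residues of e mod 2 and mod 3, e = 1 once e < 7.
no-exception-1 : ∀ {q r q′ r′} → q ≡ 1 + q′ * 3 → r ≡ 1 + r′ * 3 → r % 2 ≡ 1 → r ≤ 2 * q → ¬ (r ≤ 2 * q ∸ 7) →
  ∀ {k m} → Cut q r k m orderA → ¬ Exceptional m (k % 3) 0 0
no-exception-1 {q} {r} {q′} {r′} q≡ r≡ odd r≤2q ¬small {k} c x with ℕₚ.m≤n⇒∃[o]m+o≡n r≤2q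
... | e , eq with e <? 7
...   | no ≮ = ¬small (ℕₚ.m+n≤o⇒m≤o∸n r (ℕₚ.≤-trans (ℕₚ.+-monoʳ-≤ r (ℕₚ.≮⇒≥ ≮)) (ℕₚ.≤-reflexive eq)))
...   | yes e<7 with small-gap-1 e<7 (gap-parity {q} {r} odd eq) (gap-mod-3 {ρ = 0} {q′} {r′} q≡ r≡ eq)
...     | refl = impossible c x
  where
  residue : ∀ {κ j} n → n ≡ κ + j * 3 → n % 3 ≡ κ % 3
  residue {κ} {j} n eq = trans (cong (_% 3) eq) ([m+kn]%n≡m%n κ j 3)
  impossible : ∀ {m} → Cut q r k m orderA → ¬ Exceptional m (k % 3) 0 0
  -- Three exponents at most k: r ≤ k < 2q = r + 1, so k = r ≡ 1 (mod 3), whereas residue 2 is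
  -- required.
  impossible (below _ (below _ (below h (above l _)))) (_ , inj₁ (refl , κ≡2)) = contradiction κ≡2 (trans (cong (_% 3) k≡r) (residue {1} {r′} r r≡))
    where
    k≡r : k ≡ r
    k≡r = ℕₚ.≤-antisym (ℕₚ.≤-pred (ℕₚ.≤-trans l (ℕₚ.≤-reflexive (trans (ℕₚ.+-identityʳ (2 * q)) (trans (sym eq) (ℕₚ.+-comm r 1))))))
            (ℕₚ.≤-trans (ℕₚ.≤-reflexive (sym (ℕₚ.+-identityʳ r))) h)
    contradiction : k % 3 ≡ 2 → k % 3 ≡ 1 → ⊥
    contradiction e₁ e₂ with () ← trans (sym e₁) e₂
  -- Six exponents at most k: 2r ≤ k < 2q + r = 2r + 1, so k = 2r ≡ 2 (mod 3), whereas residue 0 is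
  -- required.
  impossible (below _ (below _ (below _ (below _ (below _ (below h (above l _))))))) (_ , inj₂ (refl , κ≡0)) =
    contradiction κ≡0 (trans (cong (_% 3) (trans k≡2r (trans (cong (2 *_) r≡) (double r′)))) ([m+kn]%n≡m%n 2 (2 * r′) 3))
    where
    double : ∀ j → 2 * (1 + j * 3) ≡ 2 + 2 * j * 3
    double = ℕ-solve-∀
    top : ∀ r → 1 + 2 * r ≡ (r + 1) + 1 * r
    top = ℕ-solve-∀
    k≡2r : k ≡ 2 * r
    k≡2r = ℕₚ.≤-antisym (ℕₚ.≤-pred (ℕₚ.≤-trans l (ℕₚ.≤-reflexive (trans (cong (_+ 1 * r) (sym eq)) (sym (top r)))))) h
    contradiction : k % 3 ≡ 0 → k % 3 ≡ 2 → ⊥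
    contradiction e₁ e₂ with () ← trans (sym e₁) e₂

-- From coefficient bounds to the sets of values.

∣v∣≤1⇒∈ : ∀ {v} → ℤ.∣ v ∣ ≤ 1 → v ∈ -[1+ 0 ] ∷ + 0 ∷ + 1 ∷ []
∣v∣≤1⇒∈ {+ 0}         _ = there (here refl)
∣v∣≤1⇒∈ {+ 1}         _ = there (there (here refl))
∣v∣≤1⇒∈ { -[1+ 0 ]}   _ = here refl
∣v∣≤1⇒∈ {+ (suc (suc _))} (s≤s ())
∣v∣≤1⇒∈ { -[1+ suc _ ]}   (s≤s ())

∣v∣≤2⇒∈ : ∀ {v} → ℤ.∣ v ∣ ≤ 2 → v ∈ -[1+ 1 ] ∷ -[1+ 0 ] ∷ + 0 ∷ + 1 ∷ + 2 ∷ []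
∣v∣≤2⇒∈ {+ 0}         _ = there (there (here refl))
∣v∣≤2⇒∈ {+ 1}         _ = there (there (there (here refl)))
∣v∣≤2⇒∈ {+ 2}         _ = there (there (there (there (here refl))))
∣v∣≤2⇒∈ { -[1+ 0 ]}   _ = there (here refl)
∣v∣≤2⇒∈ { -[1+ 1 ]}   _ = here refl
∣v∣≤2⇒∈ {+ (suc (suc (suc _)))} (s≤s (s≤s ()))
∣v∣≤2⇒∈ { -[1+ suc (suc _) ]}   (s≤s (s≤s ()))

Attained : (ℕ → ℤ) → ℕ → ℤ → Set
Attained C N v = ∃ λ k → (k ≤ N) × (C k ≡ v)

-- C is the coefficient sequence of (X^D - 1) F, where f is that of F, and F has degree below D.
module Coefficients {C f : ℕ → ℤ} {D N : ℕ}
  (C-eq : ∀ k → C k ≡ shift D f k ℤ.+ ℤ.- f k) (f-vanish : ∀ {k} → D ≤ k → f k ≡ + 0)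
  (5≤D : 5 ≤ D) (D≤N : D ≤ N) (f0 : f 0 ≡ + 1) (f1 : f 1 ≡ -[1+ 0 ]) (f2 : f 2 ≡ + 0) where

  C-low : ∀ {k} → k < D → C k ≡ ℤ.- f k
  C-low {k} l = trans (C-eq k) (trans (cong (ℤ._+ ℤ.- f k) (shift-< {D} f l)) (ℤₚ.+-identityˡ _))

  C-high : ∀ k → C (k + D) ≡ f k
  C-high k = trans (C-eq (k + D)) (trans (cong₂ ℤ._+_ (trans (shift-≥ {D} f (ℕₚ.m≤n+m D k)) (cong f (ℕₚ.m+n∸n≡m k D)))
    (cong ℤ.-_ (f-vanish (ℕₚ.m≤n+m D k)))) (ℤₚ.+-identityʳ _))

  C-bound : ∀ {B} → (∀ k → ℤ.∣ f k ∣ ≤ B) → ∀ k → ℤ.∣ C k ∣ ≤ B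
  C-bound {B} h k with k <? D
  ... | yes l = subst (_≤ B) (sym (trans (cong ℤ.∣_∣ (C-low l)) (ℤₚ.∣-i∣≡∣i∣ (f k)))) (h k)
  ... | no ≮  = subst (λ j → ℤ.∣ C j ∣ ≤ B) (ℕₚ.m∸n+n≡m (ℕₚ.≮⇒≥ ≮))
                  (subst (λ v → ℤ.∣ v ∣ ≤ B) (sym (C-high (k ∸ D))) (h (k ∸ D)))

  attained-low : ∀ {k v} → k < D → ℤ.- f k ≡ v → Attained C N v
  attained-low {k} l e = k , ℕₚ.≤-trans (ℕₚ.<⇒≤ l) D≤N , trans (C-low l) e

  attained--1 : Attained C N -[1+ 0 ]
  attained--1 = attained-low (ℕₚ.≤-trans (s≤s z≤n) 5≤D) (cong ℤ.-_ f0)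

  attained-0 : Attained C N (+ 0)
  attained-0 = attained-low (ℕₚ.≤-trans (s≤s (s≤s (s≤s z≤n))) 5≤D) (cong ℤ.-_ f2)

  attained-1 : Attained C N (+ 1)
  attained-1 = attained-low (ℕₚ.≤-trans (s≤s (s≤s z≤n)) 5≤D) (cong ℤ.-_ f1)

  flat-values : (∀ k → ℤ.∣ f k ∣ ≤ 1) → ∀ v → Attained C N v ⇔ (v ∈ -[1+ 0 ] ∷ + 0 ∷ + 1 ∷ [])
  flat-values h v = mk⇔ (λ { (k , _ , e) → ∣v∣≤1⇒∈ (subst (λ w → ℤ.∣ w ∣ ≤ 1) e (C-bound h k)) })
    λ { (here refl) → attained--1 ; (there (here refl)) → attained-0 ; (there (there (here refl))) → attained-1 }

  height-2-values : (∀ k → ℤ.∣ f k ∣ ≤ 2) → Attained C N -[1+ 1 ] → Attained C N (+ 2) →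
    ∀ v → Attained C N v ⇔ (v ∈ -[1+ 1 ] ∷ -[1+ 0 ] ∷ + 0 ∷ + 1 ∷ + 2 ∷ [])
  height-2-values h a-2 a2 v = mk⇔ (λ { (k , _ , e) → ∣v∣≤2⇒∈ (subst (λ w → ℤ.∣ w ∣ ≤ 2) e (C-bound h k)) })
    λ { (here refl) → a-2 ; (there (here refl)) → attained--1 ; (there (there (here refl))) → attained-0
      ; (there (there (there (here refl)))) → attained-1 ; (there (there (there (there (here refl))))) → a2 }

-- Size estimates and the three cases for V₃qr.

odd≢ : ∀ {q m} → q % 2 ≡ 1 → m % 2 ≡ 0 → ¬ m ≡ q
odd≢ e₁ e₂ refl with () ← trans (sym e₁) e₂

residue-cases : ∀ {q} → Prime q → 3 < q → ∃ λ ρ → (ρ < 2) × (q % 3 ≡ 1 + ρ) × (q ≡ 1 + ρ + q / 3 * 3)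
residue-cases {q} pq 3<q with q % 3 in e | m≡m%n+[m/n]*n q 3 | m%n<n q 3
... | 0 | eq | _ = ⊥-elim (prime≢⇒∤ prime[3] pq (ℕₚ.<⇒≢ 3<q) (divides (q / 3) eq))
... | 1 | eq | _ = 0 , s≤s z≤n , refl , eq
... | 2 | eq | _ = 1 , s≤s (s≤s z≤n) , refl , eq
... | suc (suc (suc _)) | _ | s≤s (s≤s (s≤s ()))

-- Equivalent to (q - 2)(r - 2) ≥ 4. The largest exponent is 2q + 2r, so F vanishes from degree qr
-- on, and the copies -F and X^qr F do not overlap.
2q+2r≤qr : ∀ {q r} → 5 ≤ q → 5 ≤ r → 2 * q + 2 * r ≤ q * r
2q+2r≤qr {q} {r} 5≤q 5≤r with ℕₚ.m≤n⇒∃[o]m+o≡n 5≤q | ℕₚ.m≤n⇒∃[o]m+o≡n 5≤r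
... | a , refl | b , refl = ≤-by (5 + 3 * a + 3 * b + a * b) (lem a b)
  where
  lem : ∀ a b → 2 * (5 + a) + 2 * (5 + b) + (5 + 3 * a + 3 * b + a * b) ≡ (5 + a) * (5 + b)
  lem = ℕ-solve-∀

theorem5 : (q r : ℕ) → Prime q → Prime r → q % 2 ≡ 1 → r % 2 ≡ 1 → 3 < q → q < r →
    ((q % 3 ≡ 1) × (r % 3 ≡ 1) × (r ≤ 2 * q ∸ 7) →
      (∀ v → InV (3 * q * r) v ⇔ (v ∈ (-[1+ 1 ] ∷ -[1+ 0 ] ∷ + 0 ∷ + 1 ∷ + 2 ∷ [])))
      × (c (3 * q * r) (r + 1) ≡ + 2)
      × (c (3 * q * r) (r + 1 + q * r) ≡ -[1+ 1 ]))
    × ((q % 3 ≡ 2) × (r % 3 ≡ 2) × (r ≤ 2 * q ∸ 3) →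
      (∀ v → InV (3 * q * r) v ⇔ (v ∈ (-[1+ 1 ] ∷ -[1+ 0 ] ∷ + 0 ∷ + 1 ∷ + 2 ∷ [])))
      × (c (3 * q * r) r ≡ -[1+ 1 ])
      × (c (3 * q * r) (r + q * r) ≡ + 2))
    × (¬ ((q % 3 ≡ 1) × (r % 3 ≡ 1) × (r ≤ 2 * q ∸ 7)) →
       ¬ ((q % 3 ≡ 2) × (r % 3 ≡ 2) × (r ≤ 2 * q ∸ 3)) →
      (∀ v → InV (3 * q * r) v ⇔ (v ∈ (-[1+ 0 ] ∷ + 0 ∷ + 1 ∷ [])))
      × Flat (Ψ (3 * q * r)))
theorem5 q r pq pr q-odd r-odd 3<q q<r = part-1 , part-2 , part-3
  where
  n = 3 * q * r
  n≡ : n ≡ 3 * (q * r)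
  n≡ = ℕₚ.*-assoc 3 q r
  5≤q : 5 ≤ q
  5≤q = ℕₚ.≤∧≢⇒< 3<q (odd≢ q-odd refl)
  5≤r : 5 ≤ r
  5≤r = ℕₚ.≤-trans 5≤q (ℕₚ.<⇒≤ q<r)
  q-residue = residue-cases pq 3<q
  r-residue = residue-cases pr (ℕₚ.<-trans 3<q q<r)
  ρ = proj₁ q-residue
  ρ<2 = proj₁ (proj₂ q-residue)
  q%3 = proj₁ (proj₂ (proj₂ q-residue))
  q≡ = proj₂ (proj₂ (proj₂ q-residue))
  σ = proj₁ r-residue
  σ<2 = proj₁ (proj₂ r-residue)
  r%3 = proj₁ (proj₂ (proj₂ r-residue))
  r≡ = proj₂ (proj₂ (proj₂ r-residue))
  open Residues {q} {r} {ρ} {σ} (q / 3) (r / 3) q≡ r≡ ρ<2 σ<2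
  not-3 : ∀ {k τ} j → τ < 2 → k ≡ 1 + τ + j * 3 → NotMultipleOf3 k
  not-3 {τ = 0} j _ e = inj₁ (j , e)
  not-3 {τ = 1} j _ e = inj₂ (j , e)
  not-3 {τ = suc (suc _)} j (s≤s (s≤s ())) e
  factorisation = Ψ-factorisation pq pr (ℕₚ.<⇒≢ q<r) (not-3 (q / 3) ρ<2 q≡) (not-3 (r / 3) σ<2 r≡)
  F = proj₁ factorisation
  f = coeff F
  geo⊗F : geo 1 3 ⊗ F ≈ geo q 3 ⊗ geo r 3
  geo⊗F = proj₂ (proj₂ factorisation)
  f-A : ∀ k → f k ≡ series q r orderA k
  f-A = coeff-series q r {F} orderA (≈-trans geo⊗F (expand-A q r))
  f-B : ∀ k → f k ≡ series q r orderB k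
  f-B = coeff-series q r {F} orderB (≈-trans geo⊗F (expand-B q r))
  C-eq : ∀ k → c n k ≡ shift (q * r) f k ℤ.+ ℤ.- f k
  C-eq k = trans (cong (λ m → c m k) n≡) (trans (at (proj₁ (proj₂ factorisation)) k) (coeff-Δ⊗ (q * r) F k))
  deg-bound : 2 * q + 2 * r ≤ q * r
  deg-bound = 2q+2r≤qr 5≤q 5≤r
  k<q⇒f : ∀ {k} → k < q → f k ≡ u (k + 0) ℤ.+ + 0
  k<q⇒f {k} k<q with ℕₚ.≤-total r (2 * q)
  ... | inj₁ r≤2q = trans (f-A k) (series-initial k<q (increasing-≤ (ℕₚ.<⇒≤ q<r) r≤2q))
  ... | inj₂ 2q≤r = trans (f-B k) (series-initial k<q (increasing-≥ 2q≤r))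
  f-vanish : ∀ {k} → q * r ≤ k → f k ≡ + 0
  f-vanish {k} l with ℕₚ.≤-total r (2 * q)
  ... | inj₁ r≤2q = trans (f-A k) (series-A-vanish (increasing-≤ (ℕₚ.<⇒≤ q<r) r≤2q) (ℕₚ.≤-trans deg-bound l))
  ... | inj₂ 2q≤r = trans (f-B k) (series-B-vanish (increasing-≥ 2q≤r) (ℕₚ.≤-trans deg-bound l))
  N = n ∸ totient n
  -- The largest index at which a value is exhibited is r + 1 + qr; it has to lie in the range of V.
  N-bound : q * r + (r + 1) ≤ N
  N-bound = ℕₚ.m+n≤o⇒m≤o∸n (q * r + (r + 1)) (subst (λ m → q * r + (r + 1) + totient m ≤ m) (sym n≡)
    (subst (_≤ 3 * (q * r)) (ℕₚ.+-comm (totient (3 * (q * r))) (q * r + (r + 1))) (totient-3qr pq (ℕₚ.<⇒≢ 3<q) (prime≥1 pr))))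
  r+1<qr : r + 1 < q * r
  r+1<qr = ℕₚ.<-≤-trans (ℕₚ.+-monoʳ-< r (ℕₚ.≤-trans (s≤s (s≤s z≤n)) 5≤r))
    (ℕₚ.≤-trans (ℕₚ.≤-reflexive (cong (_+_ r) (sym (ℕₚ.+-identityʳ r)))) (ℕₚ.*-monoˡ-≤ r (ℕₚ.≤-trans (s≤s (s≤s z≤n)) 5≤q)))
  r<qr : r < q * r
  r<qr = ℕₚ.≤-<-trans (ℕₚ.m≤m+n r 1) r+1<qr
  open Coefficients {c n} {f} {q * r} {N} C-eq f-vanish (ℕₚ.*-mono-≤ 5≤q (prime≥1 pr))
    (ℕₚ.≤-trans (ℕₚ.m≤m+n (q * r) (r + 1)) N-bound)
    (k<q⇒f (ℕₚ.≤-trans (s≤s z≤n) 5≤q)) (k<q⇒f (ℕₚ.≤-trans (s≤s (s≤s z≤n)) 5≤q)) (k<q⇒f (ℕₚ.≤-trans (s≤s (s≤s (s≤s z≤n))) 5≤q))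
  attained-high : ∀ {k v} → k ≤ r + 1 → f k ≡ v → Attained (c n) N v
  attained-high {k} l e = k + q * r , ℕₚ.≤-trans (ℕₚ.≤-trans (ℕₚ.+-monoˡ-≤ (q * r) l) (ℕₚ.≤-reflexive (ℕₚ.+-comm (r + 1) (q * r)))) N-bound , trans (C-high k) e
  ∣f∣≤2 : r ≤ 2 * q → ∀ k → ℤ.∣ f k ∣ ≤ 2
  ∣f∣≤2 r≤2q k = subst (λ v → ℤ.∣ v ∣ ≤ 2) (sym (f-A k))
    ([ ℕₚ.m≤n⇒m≤1+n , proj₁ ]′ (series-A-bound (increasing-≤ (ℕₚ.<⇒≤ q<r) r≤2q) k))
  -- Three of the nine exponents, 0, q and r, are at most k.
  f-between : ∀ {k} → r ≤ 2 * q → r ≤ k → k < 2 * q → f k ≡ value (1 + ρ) (1 + σ) (take 3 orderA) (k % 3)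
  f-between {k} r≤2q r≤k k<2q with increasing-≤ (ℕₚ.<⇒≤ q<r) r≤2q
  ... | _ ◂ _ ◂ _ ◂ inc = trans (f-A k) (series-value (below {x = 0 , 0} z≤n (below {x = 1 , 0} q≤k (below {x = 0 , 1} r≤k′
        (cut-0 q r (subst (k <_) (sym (ℕₚ.+-identityʳ (2 * q))) k<2q) inc)))))
    where
    q≤k : 1 * q + 0 * r ≤ k
    q≤k = subst (_≤ k) (sym (trans (ℕₚ.+-identityʳ (q + 0)) (ℕₚ.+-identityʳ q))) (ℕₚ.≤-trans (ℕₚ.<⇒≤ q<r) r≤k)
    r≤k′ : 0 * q + 1 * r ≤ k
    r≤k′ = subst (_≤ k) (sym (ℕₚ.+-identityʳ r)) r≤k
  value-at : ∀ {κ τ τ′ w} → q % 3 ≡ 1 + τ → r % 3 ≡ 1 + τ′ → κ % 3 ≡ w →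
    value (1 + ρ) (1 + σ) (take 3 orderA) (κ % 3) ≡ value (1 + τ) (1 + τ′) (take 3 orderA) w
  value-at {κ} {τ} {τ′} e₁ e₂ e₃ = trans (cong (λ a → value a (1 + σ) (take 3 orderA) (κ % 3)) (trans (sym q%3) e₁))
    (trans (cong (λ b → value (1 + τ) b (take 3 orderA) (κ % 3)) (trans (sym r%3) e₂))
      (cong (value (1 + τ) (1 + τ′) (take 3 orderA)) e₃))

  part-1 : (q % 3 ≡ 1) × (r % 3 ≡ 1) × (r ≤ 2 * q ∸ 7) →
      (∀ v → InV n v ⇔ (v ∈ (-[1+ 1 ] ∷ -[1+ 0 ] ∷ + 0 ∷ + 1 ∷ + 2 ∷ [])))
      × (c n (r + 1) ≡ + 2) × (c n (r + 1 + q * r) ≡ -[1+ 1 ])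
  part-1 (e₁ , e₂ , r≤) = height-2-values (∣f∣≤2 r≤2q) (attained-high ℕₚ.≤-refl f≡-2) (attained-low r+1<qr (cong ℤ.-_ f≡-2)) ,
      trans (C-low r+1<qr) (cong ℤ.-_ f≡-2) , trans (C-high (r + 1)) f≡-2
    where
    r≤2q : r ≤ 2 * q
    r≤2q = ℕₚ.≤-trans r≤ (ℕₚ.m∸n≤m (2 * q) 7)
    7≤2q : 7 ≤ 2 * q
    7≤2q = ℕₚ.≤-trans (ℕₚ.m≤m+n 7 3) (ℕₚ.*-monoʳ-≤ 2 5≤q)
    r+1<2q : r + 1 < 2 * q
    r+1<2q = ℕₚ.<-≤-trans (ℕₚ.+-monoʳ-< r (s≤s (s≤s z≤n))) (ℕₚ.≤-trans (ℕₚ.+-monoˡ-≤ 7 r≤) (ℕₚ.≤-reflexive (ℕₚ.m∸n+n≡m 7≤2q)))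
    r≡1 : r ≡ 1 + r / 3 * 3
    r≡1 = trans (m≡m%n+[m/n]*n r 3) (cong (_+ r / 3 * 3) e₂)
    -- For k = r + 1 ≡ 2 (mod 3) the exponents 0, q, r contribute u 2 = 0 and twice u 1 = -1.
    f≡-2 : f (r + 1) ≡ -[1+ 1 ]
    f≡-2 = trans (f-between r≤2q (ℕₚ.m≤m+n r 1) r+1<2q) (value-at {r + 1} {0} {0} {2} e₁ e₂
      (trans (cong (_% 3) (trans (ℕₚ.+-comm r 1) (cong suc r≡1))) ([m+kn]%n≡m%n 2 (r / 3) 3)))

  part-2 : (q % 3 ≡ 2) × (r % 3 ≡ 2) × (r ≤ 2 * q ∸ 3) →
      (∀ v → InV n v ⇔ (v ∈ (-[1+ 1 ] ∷ -[1+ 0 ] ∷ + 0 ∷ + 1 ∷ + 2 ∷ [])))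
      × (c n r ≡ -[1+ 1 ]) × (c n (r + q * r) ≡ + 2)
  part-2 (e₁ , e₂ , r≤) = height-2-values (∣f∣≤2 r≤2q) (attained-low r<qr (cong ℤ.-_ f≡2)) (attained-high (ℕₚ.m≤m+n r 1) f≡2) ,
      trans (C-low r<qr) (cong ℤ.-_ f≡2) , trans (C-high r) f≡2
    where
    r≤2q : r ≤ 2 * q
    r≤2q = ℕₚ.≤-trans r≤ (ℕₚ.m∸n≤m (2 * q) 3)
    r<2q : r < 2 * q
    r<2q = ℕₚ.≤∧≢⇒< r≤2q λ e → odd≢ r-odd (trans (cong (_% 2) (ℕₚ.*-comm 2 q)) (m*n%n≡0 q 2)) (sym e)
    -- For k = r ≡ 2 (mod 3) the exponents 0, q, r contribute u 2 = 0 and twice u 0 = 1.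
    f≡2 : f r ≡ + 2
    f≡2 = trans (f-between r≤2q ℕₚ.≤-refl r<2q) (value-at {r} {1} {1} {2} e₁ e₂ e₂)

  part-3 : ¬ ((q % 3 ≡ 1) × (r % 3 ≡ 1) × (r ≤ 2 * q ∸ 7)) → ¬ ((q % 3 ≡ 2) × (r % 3 ≡ 2) × (r ≤ 2 * q ∸ 3)) →
      (∀ v → InV n v ⇔ (v ∈ (-[1+ 0 ] ∷ + 0 ∷ + 1 ∷ []))) × Flat (Ψ n)
  part-3 ¬1 ¬2 = flat-values ∣f∣≤1 , C-bound ∣f∣≤1 , 0 , cong ℤ.∣_∣ (trans (C-low (ℕₚ.≤-<-trans z≤n r<qr)) (cong ℤ.-_ (k<q⇒f (ℕₚ.≤-trans (s≤s z≤n) 5≤q))))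
    where
    -- Stated for a variable τ, because `ρ` is a projection and cannot itself be matched against 0
    -- and 1.
    no-exception : ∀ {k m} τ → τ < 2 → q % 3 ≡ 1 + τ → q ≡ 1 + τ + q / 3 * 3 → r % 3 ≡ 1 + τ → r ≡ 1 + τ + r / 3 * 3 → r ≤ 2 * q →
      Cut q r k m orderA → ¬ Exceptional m (k % 3) τ τ
    no-exception 0 _ e₁ q≡ e₂ r≡ r≤2q = no-exception-1 {q′ = q / 3} {r / 3} q≡ r≡ r-odd r≤2q λ r≤ → ¬1 (e₁ , e₂ , r≤)
    no-exception 1 _ e₁ q≡ e₂ r≡ r≤2q _ _ with ℕₚ.m≤n⇒∃[o]m+o≡n r≤2q
    ... | e , eq with e <? 3
    ...   | no ≮ = ¬2 (e₁ , e₂ , ℕₚ.m+n≤o⇒m≤o∸n r (ℕₚ.≤-trans (ℕₚ.+-monoʳ-≤ r (ℕₚ.≮⇒≥ ≮)) (ℕₚ.≤-reflexive eq)))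
    ...   | yes e<3 = small-gap-2 e<3 (gap-parity {q} {r} r-odd eq) (gap-mod-3 {ρ = 1} {q / 3} {r / 3} q≡ r≡ eq)
    no-exception (suc (suc _)) (s≤s (s≤s ()))
    ∣f∣≤1 : ∀ k → ℤ.∣ f k ∣ ≤ 1
    ∣f∣≤1 k with ℕₚ.≤-total r (2 * q)
    ... | inj₂ 2q≤r = subst (λ v → ℤ.∣ v ∣ ≤ 1) (sym (f-B k)) (series-B-bound (increasing-≥ 2q≤r) k)
    ... | inj₁ r≤2q = subst (λ v → ℤ.∣ v ∣ ≤ 1) (sym (f-A k)) ([ (λ le → le) , (λ (_ , _ , cut′ , (ρ≡σ , x)) →
      ⊥-elim (no-exception ρ ρ<2 q%3 q≡ (trans r%3 (cong suc (sym ρ≡σ)))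
        (trans r≡ (cong (λ t → 1 + t + r / 3 * 3) (sym ρ≡σ))) r≤2q cut′ (refl , x))) ]′
      (series-A-bound (increasing-≤ (ℕₚ.<⇒≤ q<r) r≤2q) k))
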